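{- Let $Q\subset\mathbb{R}^d$ and $P\subset\mathbb{R}^e$ be lattice polytopes admitting unimodular triangulations $\mathcal S$ and $\mathcal{T}$ respectively, and let $\phi:\mathbb{R}^d\to\mathbb{R}$ be an affine function with $\phi(\mathbb{Z}^d)\subseteq\mathbb{Z}$ and $\phi\ge0$ on $Q$. Then the semidirect product $Q\ltimes_\phi P$ admits a unimodular triangulation that refines the pull-back $\pi^*\mathcal S$ of $\mathcal S$ under the projection $\pi:Q\ltimes_\phi P\to Q$.
   Context: The semidirect product is $Q\ltimes_\phi P=\operatorname{conv}\bigcup_{a\in Q}\left(\{a\}\times\phi(a)P\right)\subset\mathbb{R}^d\times\mathbb{R}^e$, and $\pi$ is the projection to the first factor. The pull-back $\pi^*\mathcal S$ is the subdivision of $Q\ltimes_\phi P$ into the sets $(Q\ltimes_\phi P)\cap\pi^{ -1}(F)$, $F\in\mathcal S$; refining it means every cell is contained in one of these. Unimodular triangulation: lattice triangulation all of whose maximal simplices are lattice-equivalent to standard unimodular simplices.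
   Formalization: Polytopes, simplices, the semidirect product, φ and the covering and intersection conditions are stated over rational points and coefficients instead of real ones; as all vertices are lattice points, the real statement follows by density and closedness. -}

module Defs where

open import Data.Nat using (ℕ; _+_)
open import Data.Integer using (ℤ)
open import Data.Rational using (ℚ; 0ℚ; 1ℚ; _≤_; _/_) renaming (_+_ to _+ℚ_; _*_ to _*ℚ_)
open import Data.Vec using (Vec; []; _∷_; replicate; zipWith; take; _++_; map)
open import Data.List using (List; []; _∷_; length; zip) renaming (map to lmap)
open import Data.List.Relation.Unary.All using (All)
open import Data.List.Membership.Propositional using (_∈_)
open import Data.Product using (Σ; ∃; _×_; _,_)
open import Relation.Binary.PropositionalEquality using (_≡_)

-- Rational points of ℝ^n.  All polytopes below have rational (indeed integral)
-- vertices, so they are determined by their rational points.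
Point : ℕ → Set
Point n = Vec ℚ n

ι : ℤ → ℚ
ι z = z / 1

IsInt : ℚ → Set
IsInt q = ∃ λ (z : ℤ) → q ≡ ι z

IsLattice : ∀ {n} → Point n → Set
IsLattice x = Data.Vec.Relation.Unary.All.All IsInt x
  where import Data.Vec.Relation.Unary.All

qsum : List ℚ → ℚ
qsum [] = 0ℚ
qsum (q ∷ qs) = q +ℚ qsum qs

origin : ∀ n → Point n
origin n = replicate n 0ℚ

_⊕_ : ∀ {n} → Point n → Point n → Point n
_⊕_ = zipWith _+ℚ_

_·_ : ∀ {n} → ℚ → Point n → Point n
c · x = map (c *ℚ_) x

lin : ∀ {n} → List (ℚ × Point n) → Point n
lin {n} [] = origin n
lin ((c , p) ∷ ws) = (c · p) ⊕ lin ws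

wsum : ∀ {n} → List (ℚ × Point n) → ℚ
wsum [] = 0ℚ
wsum ((c , _) ∷ ws) = c +ℚ wsum ws

Conv : ∀ {n} → (Point n → Set) → Point n → Set
Conv {n} R x = ∃ λ (ws : List (ℚ × Point n)) →
  All (λ w → (0ℚ ≤ Data.Product.proj₁ w) × R (Data.Product.proj₂ w)) ws
  × wsum ws ≡ 1ℚ × lin ws ≡ x

conv : ∀ {n} → List (Point n) → Point n → Set
conv V = Conv (λ y → y ∈ V)

-- A lattice polytope presented by a list of lattice points (its convex hull)
LatticePoints : ∀ {n} → List (Point n) → Set
LatticePoints V = All IsLattice V

-- Affine independence of the vertex list σ (over ℚ, equivalently over ℝ):
-- the only coefficient vector with Σλᵢ = 0 and Σλᵢvᵢ = 0 is zero.
AffIndep : ∀ {n} → List (Point n) → Set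
AffIndep {n} σ = ∀ (ls : List ℚ) → length ls ≡ length σ →
  qsum ls ≡ 0ℚ → lin (zip ls σ) ≡ origin n → All (_≡ 0ℚ) ls

InAff : ∀ {n} → List (Point n) → Point n → Set
InAff σ x = ∃ λ (ls : List ℚ) → length ls ≡ length σ × qsum ls ≡ 1ℚ × lin (zip ls σ) ≡ x

InAffℤ : ∀ {n} → List (Point n) → Point n → Set
InAffℤ σ x = ∃ λ (ks : List ℤ) → length ks ≡ length σ × qsum (lmap ι ks) ≡ 1ℚ
  × lin (zip (lmap ι ks) σ) ≡ x

-- Unimodular lattice simplex: lattice vertices, affinely independent, and
-- its vertices form an affine basis of the affine lattice aff(σ) ∩ ℤⁿ, i.e.
-- σ is lattice-equivalent to a standard unimodular simplex.
Unimodular : ∀ {n} → List (Point n) → Set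
Unimodular σ = All IsLattice σ × AffIndep σ
  × (∀ x → IsLattice x → InAff σ x → InAffℤ σ x)

-- A triangulation of the region R ⊆ ℚⁿ, given by a list of (vertex lists of)
-- simplices: every simplex is affinely independent and lies in R, the
-- simplices cover R, and any two meet in a common face (the convex hull of
-- their common vertices).
IsTriangulation : ∀ {n} → (Point n → Set) → List (List (Point n)) → Set
IsTriangulation R Σs =
  All AffIndep Σs
  × All (λ σ → ∀ x → conv σ x → R x) Σs
  × (∀ x → R x → ∃ λ σ → σ ∈ Σs × conv σ x)
  × (∀ σ τ → σ ∈ Σs → τ ∈ Σs → ∀ x → conv σ x → conv τ x →
       Conv (λ y → y ∈ σ × y ∈ τ) x)

IsUnimodularTriangulation : ∀ {n} → (Point n → Set) → List (List (Point n)) → Set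
IsUnimodularTriangulation R Σs = IsTriangulation R Σs × All Unimodular Σs

dot : ∀ {n} → Point n → Point n → ℚ
dot [] [] = 0ℚ
dot (x ∷ xs) (y ∷ ys) = x *ℚ y +ℚ dot xs ys

affine : ∀ {d} → Point d → ℚ → Point d → ℚ
affine c c₀ a = dot c a +ℚ c₀

Semidirect : ∀ {d e} → (Point d → Set) → (Point d → ℚ) → (Point e → Set) →
  Point (d + e) → Set
Semidirect {d} {e} Q φ P = Conv (λ y → ∃ λ (a : Point d) → ∃ λ (p : Point e) →
  Q a × P p × y ≡ a ++ (φ a · p))

π : ∀ {d e} → Point (d + e) → Point d
π {d} x = take d x

RefinesPullback : ∀ {d e} → List (List (Point (d + e))) → List (List (Point d)) → Set
RefinesPullback {d} {e} Σs S =
  All (λ τ → ∃ λ σ → σ ∈ S × (∀ x → conv τ x → conv σ (π {d} {e} x))) Σs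

{-# OPTIONS --safe #-}

-- Let σ and τ be cells of S and T.  The lattice points of σ ⋉ τ over a vertex v are the sums
-- v ++ (w₁ + … + wₖ) with k = φ v and w₁ ≤ … ≤ wₖ vertices of τ, for a fixed order on all points.
-- Call such a pair (v , w) a token, and order the vertices v by (φ v , v).  A cell is a list of
-- tokens in which every earlier (v , w) and later (v′ , w′) satisfy v ≥ v′ and
-- w₁ ≤ w′₁ ≤ w₂ ≤ w′₂ ≤ … .
--
-- Every affine function on the tokens over σ and τ has the form h (v , w) = f v + Σ g wᵢ.  For any
-- two distinct tokens some integral h separates the tokens that may follow the one from those
-- that may follow the other.  On a single cell, such h isolate the coefficient of the first token,
-- which gives affine independence and unimodularity; on two cells they force the first tokens of two
-- expressions of the same point to agree, which gives the common face.  To cover a point, write its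
-- coordinates over σ and τ with a common denominator N, sort the resulting N vertices decreasingly
-- and the letters increasingly, and write the letters column by column into N rows of lengths φ v.

module Submission where

open import Defs
open import Level using (0ℓ)
open import Function using (_∘_; id; const)
open import Data.Bool using (if_then_else_)
open import Data.Empty using (⊥-elim)
open import Data.Nat as ℕ using (ℕ; zero; suc; _⊓_)
import Data.Nat.Properties as ℕₚ
import Data.Nat.Coprimality as Coprime
open import Data.Integer as ℤ using (ℤ)
import Data.Integer.Properties as ℤₚ
open import Data.Rational using (ℚ; 0ℚ; 1ℚ; _+_; _*_; _-_; -_; _≤_; _/_; 1/_; mkℚ; *≤*; NonZero; Positive; nonNegative; ≢-nonZero)
open import Data.Rational.Properties as ℚₚ hiding (_≟_; _≤?_)
open import Data.Rational.Solver using (module +-*-Solver)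
import Data.Rational.Unnormalised as ℚᵘ
import Data.Rational.Unnormalised.Properties as ℚᵘ
open import Data.Vec as Vec using (Vec; lookup)
import Data.Vec.Properties as Vecₚ
import Data.Vec.Relation.Unary.All as VAll
import Data.Vec.Relation.Unary.All.Properties as VAllₚ
open import Data.Vec.Relation.Binary.Pointwise.Inductive using (Pointwise-≡⇒≡)
import Data.Vec.Relation.Binary.Lex.NonStrict as Lex
open import Data.Vec.Relation.Binary.Lex.Core using (this; next)
open import Data.List using (concatMap; cartesianProductWith; filter; deduplicate; List; []; _∷_; _++_; length; zip; map; replicate; take; drop)
open import Data.List.Properties as Listₚ using (≡-dec; length-map; length-replicate; length-take; length-drop; length-++; take++drop≡id)
open import Data.List.Relation.Unary.All as All using (All; []; _∷_)
import Data.List.Relation.Unary.All.Properties as Allₚ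
open import Data.List.Relation.Unary.AllPairs as AllPairs using (AllPairs; []; _∷_)
import Data.List.Relation.Unary.AllPairs.Properties as AllPairs
open import Data.List.Relation.Unary.Any as Any using (here; there)
open import Data.List.Relation.Unary.Sorted.TotalOrder.Properties using (Sorted⇒AllPairs)
open import Data.List.Relation.Unary.Unique.DecPropositional.Properties using (deduplicate-!)
open import Data.List.Membership.Propositional using (_∈_; find)
open import Data.List.Membership.Propositional.Properties using (∈-++⁺ˡ; ∈-++⁺ʳ; ∈-++⁻; ∈-∃++; ∈-map⁺; ∈-map⁻; ∈-filter⁺; ∈-filter⁻; ∈-deduplicate⁺; ∈-deduplicate⁻; ∈-concatMap⁺; ∈-concatMap⁻; ∈-cartesianProductWith⁺; ∈-cartesianProductWith⁻)
open import Data.List.Relation.Binary.Permutation.Propositional as Perm using (_↭_; ↭-sym)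
open import Data.List.Relation.Binary.Permutation.Propositional.Properties using (All-resp-↭)
open import Data.Product using (∃; ∃₂; _×_; _,_; proj₁; proj₂; map₁; map₂)
import Data.Product.Properties as Product
open import Data.Sum using (_⊎_; inj₁; inj₂)
open import Relation.Nullary using (Dec; yes; no; ¬_; does)
open import Relation.Nullary.Decidable as Dec using (_×-dec_; ¬?)
open import Relation.Binary using (Rel; IsDecTotalOrder; DecTotalOrder)
import Relation.Binary.Construct.Flip.EqAndOrd as Flip
open import Relation.Binary.PropositionalEquality
open ≡-Reasoning
open +-*-Solver using (solve; _:+_; _:*_; _:-_; :-_; con; _:=_)

private
  variable
    A B : Set
    n : ℕ

-- Integral rationals

-- The division by the greatest common divisor in `z / 1` does not compute for a variable `z`. The
-- explicit fraction does, so sums, products and numerators can be read off from it.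
ι-mk : ∀ z → ι z ≡ mkℚ z 0 (Coprime.sym (Coprime.1-coprimeTo ℤ.∣ z ∣))
ι-mk z = fromℚᵘ-toℚᵘ (mkℚ z 0 _)

ι-+ : ∀ a b → ι (a ℤ.+ b) ≡ ι a + ι b
ι-+ a b = begin
  (a ℤ.+ b) / 1 ≡⟨ cong (_/ 1) (sym (cong₂ ℤ._+_ (ℤₚ.*-identityʳ a) (ℤₚ.*-identityʳ b))) ⟩
  (a ℤ.* ℤ.+ 1 ℤ.+ b ℤ.* ℤ.+ 1) / 1 ≡⟨ sym (cong₂ _+_ (ι-mk a) (ι-mk b)) ⟩
  ι a + ι b ∎

ι-* : ∀ a b → ι (a ℤ.* b) ≡ ι a * ι b
ι-* a b = sym (cong₂ _*_ (ι-mk a) (ι-mk b))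

int0 : IsInt 0ℚ
int0 = ℤ.+ 0 , refl

int1 : IsInt 1ℚ
int1 = ℤ.+ 1 , refl

int-+ : ∀ {p q} → IsInt p → IsInt q → IsInt (p + q)
int-+ (a , refl) (b , refl) = a ℤ.+ b , sym (ι-+ a b)

int-* : ∀ {p q} → IsInt p → IsInt q → IsInt (p * q)
int-* (a , refl) (b , refl) = a ℤ.* b , sym (ι-* a b)

int-neg : ∀ {p} → IsInt p → IsInt (- p)
int-neg {p} i = subst IsInt (solve 1 (λ p → con (- 1ℚ) :* p := :- p) refl p) (int-* (ℤ.-[1+ 0 ] , refl) i)

int-- : ∀ {p q} → IsInt p → IsInt q → IsInt (p - q)
int-- i j = int-+ i (int-neg j)

-- Order

0≤1 : 0ℚ ≤ 1ℚ
0≤1 = nonNegative⁻¹ 1ℚ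

*-nonNeg : ∀ {p q} → 0ℚ ≤ p → 0ℚ ≤ q → 0ℚ ≤ p * q
*-nonNeg {p} {q} 0≤p 0≤q =
  subst (_≤ p * q) (*-zeroʳ p) (*-monoˡ-≤-nonNeg p {{nonNegative 0≤p}} 0≤q)

+-nonNeg : ∀ {p q} → 0ℚ ≤ p → 0ℚ ≤ q → 0ℚ ≤ p + q
+-nonNeg 0≤p 0≤q = +-mono-≤ 0≤p 0≤q

≤⇒0≤- : ∀ {p q} → p ≤ q → 0ℚ ≤ q - p
≤⇒0≤- {p} {q} p≤q = subst (_≤ q - p) (+-inverseʳ p) (+-monoˡ-≤ (- p) p≤q)

sum-zeroˡ : ∀ {p q} → 0ℚ ≤ p → 0ℚ ≤ q → p + q ≡ 0ℚ → p ≡ 0ℚ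
sum-zeroˡ {p} {q} 0≤p 0≤q eq =
  ≤-antisym (subst₂ _≤_ (+-identityʳ p) eq (+-monoʳ-≤ p 0≤q)) 0≤p

sum-zeroʳ : ∀ {p q} → 0ℚ ≤ p → 0ℚ ≤ q → p + q ≡ 0ℚ → q ≡ 0ℚ
sum-zeroʳ {p} {q} 0≤p 0≤q eq = sum-zeroˡ 0≤q 0≤p (trans (+-comm q p) eq)

inverse : ∀ {m} → 0ℚ ≤ m → m ≢ 0ℚ → ∃ λ k → 0ℚ ≤ k × m * k ≡ 1ℚ
inverse {m} 0≤m m≢0 = 1/ m , <⇒≤ (positive⁻¹ (1/ m) {{1/pos⇒pos m}}) , *-inverseʳ m
  where
  instance
    m-positive : Positive m
    m-positive = nonNeg∧nonZero⇒pos m {{nonNegative 0≤m}} {{≢-nonZero m≢0}}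
    m-nonZero : NonZero m
    m-nonZero = pos⇒nonZero m

-- Finitely supported signed measures

-- These are the lists that `lin` and `wsum` consume; weights may have any sign, and elements may
-- repeat.
Measure : Set → Set
Measure A = List (ℚ × A)

∫ : (A → ℚ) → Measure A → ℚ
∫ f [] = 0ℚ
∫ f ((c , a) ∷ M) = c * f a + ∫ f M

infix 4 _≈_
-- Tested against all functions, so that order, repetitions and zero weights in the lists do not
-- matter.
record _≈_ {A : Set} (M N : Measure A) : Set where
  constructor equal
  field at : ∀ (f : A → ℚ) → ∫ f M ≡ ∫ f N
open _≈_

≈-sym : {M N : Measure A} → M ≈ N → N ≈ M
≈-sym eq = equal λ f → sym (at eq f)

≈-trans : {M N K : Measure A} → M ≈ N → N ≈ K → M ≈ K
≈-trans p q = equal λ f → trans (at p f) (at q f)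

scale : ℚ → Measure A → Measure A
scale k = map (map₁ (k *_))

push : (A → B) → Measure A → Measure B
push g = map (map₂ g)

Supp : (A → Set) → Measure A → Set
Supp R = All (R ∘ proj₂)

NonNeg : Measure A → Set
NonNeg = All ((0ℚ ≤_) ∘ proj₁)

∫-cong : ∀ {f g : A → ℚ} M → Supp (λ a → f a ≡ g a) M → ∫ f M ≡ ∫ g M
∫-cong [] [] = refl
∫-cong ((c , a) ∷ M) (eq ∷ eqs) = cong₂ _+_ (cong (c *_) eq) (∫-cong M eqs)

∫-++ : ∀ (f : A → ℚ) M N → ∫ f (M ++ N) ≡ ∫ f M + ∫ f N
∫-++ f [] N = sym (+-identityˡ _)
∫-++ f ((c , a) ∷ M) N = trans (cong (_+_ (c * f a)) (∫-++ f M N)) (sym (+-assoc (c * f a) _ _))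

∫-scale : ∀ (f : A → ℚ) k M → ∫ f (scale k M) ≡ k * ∫ f M
∫-scale f k [] = sym (*-zeroʳ k)
∫-scale f k ((c , a) ∷ M) = trans (cong (_+_ (k * c * f a)) (∫-scale f k M))
  (solve 4 (λ k c x y → k :* c :* x :+ k :* y := k :* (c :* x :+ y)) refl k c (f a) (∫ f M))

∫-push : ∀ (f : B → ℚ) (g : A → B) M → ∫ f (push g M) ≡ ∫ (f ∘ g) M
∫-push f g [] = refl
∫-push f g ((c , a) ∷ M) = cong (_+_ (c * f (g a))) (∫-push f g M)

∫-+ : ∀ (f g : A → ℚ) M → ∫ (λ a → f a + g a) M ≡ ∫ f M + ∫ g M
∫-+ f g [] = refl
∫-+ f g ((c , a) ∷ M) = trans (cong (_+_ (c * (f a + g a))) (∫-+ f g M))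
  (solve 5 (λ c x y u v → c :* (x :+ y) :+ (u :+ v) := c :* x :+ u :+ (c :* y :+ v))
    refl c (f a) (g a) (∫ f M) (∫ g M))

∫-* : ∀ k (f : A → ℚ) M → ∫ (λ a → k * f a) M ≡ k * ∫ f M
∫-* k f [] = sym (*-zeroʳ k)
∫-* k f ((c , a) ∷ M) = trans (cong (_+_ (c * (k * f a))) (∫-* k f M))
  (solve 4 (λ k c x y → c :* (k :* x) :+ k :* y := k :* (c :* x :+ y)) refl k c (f a) (∫ f M))

∫-nonNeg : ∀ {f : A → ℚ} {M} → NonNeg M → Supp (λ a → 0ℚ ≤ f a) M → 0ℚ ≤ ∫ f M
∫-nonNeg [] [] = ≤-refl
∫-nonNeg (c ∷ cs) (a ∷ as) = +-nonNeg (*-nonNeg c a) (∫-nonNeg cs as)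

∫-nonPos : ∀ {f : A → ℚ} {M} → NonNeg M → Supp (λ a → f a ≤ 0ℚ) M → ∫ f M ≤ 0ℚ
∫-nonPos [] [] = ≤-refl
∫-nonPos {f = f} {M = (c , b) ∷ M} (0≤c ∷ cs) (a ∷ as) =
  +-mono-≤ (subst (c * f b ≤_) (*-zeroʳ c) (*-monoˡ-≤-nonNeg c {{nonNegative 0≤c}} a)) (∫-nonPos cs as)

_⊖_ : Measure A → Measure A → Measure A
M ⊖ N = M ++ scale (- 1ℚ) N

∫-⊖ : ∀ (f : A → ℚ) M N → ∫ f (M ⊖ N) ≡ ∫ f M - ∫ f N
∫-⊖ f M N = trans (∫-++ f M _) (cong (_+_ (∫ f M)) (trans (∫-scale f (- 1ℚ) N)
  (solve 1 (λ p → con (- 1ℚ) :* p := :- p) refl (∫ f N))))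

scale-supp : ∀ {R : A → Set} {k M} → Supp R M → Supp R (scale k M)
scale-supp = Allₚ.map⁺

push-supp : ∀ {R : B → Set} {g : A → B} {M} → Supp (R ∘ g) M → Supp R (push g M)
push-supp = Allₚ.map⁺

push-nonNeg : ∀ {g : A → B} {M} → NonNeg M → NonNeg (push g M)
push-nonNeg = Allₚ.map⁺

scale-nonNeg : ∀ {k} {M : Measure A} → 0ℚ ≤ k → NonNeg M → NonNeg (scale k M)
scale-nonNeg 0≤k = Allₚ.map⁺ ∘ All.map (*-nonNeg 0≤k)

wsum≡∫ : (M : Measure (Point n)) → wsum M ≡ ∫ (const 1ℚ) M
wsum≡∫ [] = refl
wsum≡∫ ((c , _) ∷ M) = cong₂ _+_ (sym (*-identityʳ c)) (wsum≡∫ M)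

lookup-lin : ∀ (M : Measure (Point n)) i → lookup (lin M) i ≡ ∫ (λ v → lookup v i) M
lookup-lin [] i = Vecₚ.lookup-replicate i 0ℚ
lookup-lin ((c , p) ∷ M) i = trans (Vecₚ.lookup-zipWith _+_ i (c · p) (lin M))
  (cong₂ _+_ (Vecₚ.lookup-map i (c *_) p) (lookup-lin M i))

vec-ext : {u v : Vec A n} → (∀ i → lookup u i ≡ lookup v i) → u ≡ v
vec-ext {u = u} {v} eq = trans (sym (Vecₚ.tabulate∘lookup u))
  (trans (Vecₚ.tabulate-cong eq) (Vecₚ.tabulate∘lookup v))

wsum-cong : {M N : Measure (Point n)} → M ≈ N → wsum M ≡ wsum N
wsum-cong {M = M} {N} eq = trans (wsum≡∫ M) (trans (at eq _) (sym (wsum≡∫ N)))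

lin-cong : {M N : Measure (Point n)} → M ≈ N → lin M ≡ lin N
lin-cong {M = M} {N} eq = vec-ext λ i →
  trans (lookup-lin M i) (trans (at eq _) (sym (lookup-lin N i)))

wsum-scale : ∀ k (M : Measure (Point n)) → wsum (scale k M) ≡ k * wsum M
wsum-scale k M = trans (wsum≡∫ (scale k M)) (trans (∫-scale _ k M) (cong (k *_) (sym (wsum≡∫ M))))

lin-scale : ∀ k (M : Measure (Point n)) → lin (scale k M) ≡ k · lin M
lin-scale k M = vec-ext λ i → trans (lookup-lin (scale k M) i) (trans (∫-scale _ k M)
  (trans (cong (k *_) (sym (lookup-lin M i))) (sym (Vecₚ.lookup-map i (k *_) (lin M)))))

wsum-⊖ : (M N : Measure (Point n)) → wsum M ≡ wsum N → wsum (M ⊖ N) ≡ 0ℚ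
wsum-⊖ M N eq = trans (wsum≡∫ (M ⊖ N)) (trans (∫-⊖ _ M N)
  (trans (cong₂ _-_ (sym (wsum≡∫ M)) (sym (wsum≡∫ N))) (trans (cong (_- wsum N) eq) (+-inverseʳ (wsum N)))))

lin-⊖ : (M N : Measure (Point n)) → lin M ≡ lin N → lin (M ⊖ N) ≡ origin n
lin-⊖ M N eq = vec-ext λ i → trans (lookup-lin (M ⊖ N) i) (trans (∫-⊖ _ M N)
  (trans (cong₂ _-_ (trans (sym (lookup-lin M i)) (cong (λ v → lookup v i) eq)) (sym (lookup-lin N i)))
    (trans (+-inverseʳ (lookup (lin N) i)) (sym (Vecₚ.lookup-replicate i 0ℚ)))))

-- Measures supported on a list

-- `AffIndep` and `InAff` speak of coefficients listed along `σ`, whereas a measure may list its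
-- elements in any order. The last component keeps nonnegativity when weights are gathered.
Collected : List A → Measure A → Set
Collected σ M = ∃ λ ls → length ls ≡ length σ × zip ls σ ≈ M × (NonNeg M → All (0ℚ ≤_) ls)

∫-zeros : ∀ (f : A → ℚ) σ → ∫ f (zip (replicate (length σ) 0ℚ) σ) ≡ 0ℚ
∫-zeros f [] = refl
∫-zeros f (a ∷ σ) = trans (cong₂ _+_ (*-zeroˡ (f a)) (∫-zeros f σ)) (+-identityˡ 0ℚ)

addAt : ∀ {a : A} {σ} → a ∈ σ → ℚ → List ℚ → List ℚ
addAt _ c [] = []
addAt (here _) c (l ∷ ls) = (c + l) ∷ ls
addAt (there i) c (l ∷ ls) = l ∷ addAt i c ls

addAt-length : ∀ {a : A} {σ} (i : a ∈ σ) c ls → length (addAt i c ls) ≡ length ls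
addAt-length i c [] = refl
addAt-length (here _) c (l ∷ ls) = refl
addAt-length (there i) c (l ∷ ls) = cong suc (addAt-length i c ls)

addAt-nonNeg : ∀ {a : A} {σ} (i : a ∈ σ) {c ls} → 0ℚ ≤ c → All (0ℚ ≤_) ls → All (0ℚ ≤_) (addAt i c ls)
addAt-nonNeg i 0≤c [] = []
addAt-nonNeg (here _) 0≤c (p ∷ ps) = +-nonNeg 0≤c p ∷ ps
addAt-nonNeg (there i) 0≤c (p ∷ ps) = p ∷ addAt-nonNeg i 0≤c ps

∫-addAt : ∀ (f : A → ℚ) {a σ} (i : a ∈ σ) c ls → length ls ≡ length σ →
  ∫ f (zip (addAt i c ls) σ) ≡ c * f a + ∫ f (zip ls σ)
∫-addAt f {σ = b ∷ σ} (here refl) c (l ∷ ls) eq =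
  solve 4 (λ c l x y → (c :+ l) :* x :+ y := c :* x :+ (l :* x :+ y)) refl c l (f b) (∫ f (zip ls σ))
∫-addAt f {a} {σ = b ∷ σ} (there i) c (l ∷ ls) eq =
  trans (cong (_+_ (l * f b)) (∫-addAt f i c ls (cong ℕ.pred eq)))
    (solve 3 (λ x y z → x :+ (y :+ z) := y :+ (x :+ z)) refl (l * f b) (c * f a) (∫ f (zip ls σ)))

collect : ∀ {σ : List A} {M} → Supp (_∈ σ) M → Collected σ M
collect {σ = σ} {M = []} [] =
  replicate (length σ) 0ℚ , length-replicate (length σ) , equal (λ f → ∫-zeros f σ) ,
  λ _ → Allₚ.replicate⁺ (length σ) ≤-refl
collect {M = (c , a) ∷ M} (i ∷ is) with collect is
... | ls , len , eq , nn = addAt i c ls , trans (addAt-length i c ls) len ,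
  equal (λ f → trans (∫-addAt f i c ls len) (cong (_+_ (c * f a)) (at eq f))) ,
  λ { (p ∷ ps) → addAt-nonNeg i p (nn ps) }

qsum≡wsum : ∀ ls (σ : List (Point n)) → length ls ≡ length σ → qsum ls ≡ wsum (zip ls σ)
qsum≡wsum [] [] eq = refl
qsum≡wsum (l ∷ ls) (_ ∷ σ) eq = cong (l +_) (qsum≡wsum ls σ (cong ℕ.pred eq))

zip-supp : ∀ (ls : List ℚ) (σ : List A) → Supp (_∈ σ) (zip ls σ)
zip-supp [] σ = []
zip-supp (l ∷ ls) [] = []
zip-supp (l ∷ ls) (a ∷ σ) = here refl ∷ All.map there (zip-supp ls σ)

∫-zero : ∀ (f : A → ℚ) {ls} σ → All (_≡ 0ℚ) ls → ∫ f (zip ls σ) ≡ 0ℚ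
∫-zero f σ [] = refl
∫-zero f [] (_ ∷ _) = refl
∫-zero f (a ∷ σ) (refl ∷ es) = trans (cong₂ _+_ (*-zeroˡ (f a)) (∫-zero f σ es)) (+-identityˡ 0ℚ)

-- Affinely independent and unimodular vertex lists

-- Once the weights are gathered along `σ`, affine independence makes each of them zero, so even a
-- function that is not affine integrates to zero.
vanishing : ∀ {σ : List (Point n)} {M} → AffIndep σ → Supp (_∈ σ) M →
  wsum M ≡ 0ℚ → lin M ≡ origin n → ∀ f → ∫ f M ≡ 0ℚ
vanishing {σ = σ} ind supp w l f with collect supp
... | ls , len , eq , _ = trans (sym (at eq f)) (∫-zero f σ
  (ind ls len (trans (qsum≡wsum ls σ len) (trans (wsum-cong eq) w)) (trans (lin-cong eq) l)))

determined : ∀ {σ : List (Point n)} {M N} → AffIndep σ → Supp (_∈ σ) M → Supp (_∈ σ) N →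
  wsum M ≡ wsum N → lin M ≡ lin N → M ≈ N
determined {M = M} {N} ind sM sN w l = equal λ f → begin
  ∫ f M ≡⟨ solve 2 (λ x y → x := x :- y :+ y) refl (∫ f M) (∫ f N) ⟩
  ∫ f M - ∫ f N + ∫ f N ≡⟨ cong (_+ ∫ f N) (trans (sym (∫-⊖ f M N))
    (vanishing {M = M ⊖ N} ind (Allₚ.++⁺ sM (scale-supp {k = - 1ℚ} sN)) (wsum-⊖ M N w) (lin-⊖ M N l) f)) ⟩
  0ℚ + ∫ f N ≡⟨ +-identityˡ _ ⟩
  ∫ f N ∎

∫-int : ∀ {f : A → ℚ} (ks : List ℤ) (σ : List A) → (∀ a → IsInt (f a)) → IsInt (∫ f (zip (map ι ks) σ))
∫-int [] σ int = int0
∫-int (k ∷ ks) [] int = int0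
∫-int (k ∷ ks) (a ∷ σ) int = int-+ (int-* (k , refl) (int a)) (∫-int ks σ int)

-- Unimodularity gives the lattice point `lin M` integer coordinates, and by `determined` the
-- measure they define is equal to `M`.
integral₁ : ∀ {σ : List (Point n)} {M} {f : Point n → ℚ} → Unimodular σ → Supp (_∈ σ) M →
  wsum M ≡ 1ℚ → IsLattice (lin M) → (∀ a → IsInt (f a)) → IsInt (∫ f M)
integral₁ {σ = σ} {M} {f} (_ , ind , uni) supp w lat int with collect supp
... | ls , len , eq , _ with uni (lin M) lat (ls , len , trans (qsum≡wsum ls σ len) (trans (wsum-cong eq) w) , lin-cong eq)
... | ks , klen , ksum , klin = subst IsInt
  (at (determined {M = zip (map ι ks) σ} {M} ind (zip-supp _ σ) supp
    (trans (sym (qsum≡wsum (map ι ks) σ (trans (length-map ι ks) klen))) (trans ksum (sym w))) klin) f)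
  (∫-int ks σ int)

lattice-lin : ∀ {c} {p q : Point n} → IsInt c → IsLattice p → IsLattice q → IsLattice ((c · p) ⊕ q)
lattice-lin i VAll.[] VAll.[] = VAll.[]
lattice-lin i (p VAll.∷ ps) (q VAll.∷ qs) = int-+ (int-* i p) q VAll.∷ lattice-lin i ps qs

-- A multiple of w₀ moves the total mass to 1.
integral : ∀ {σ : List (Point n)} {M w₀} {f : Point n → ℚ} → Unimodular σ → w₀ ∈ σ → Supp (_∈ σ) M →
  IsInt (wsum M) → IsLattice (lin M) → (∀ a → IsInt (f a)) → IsInt (∫ f M)
integral {M = M} {w₀} {f} uni@(lat , _) w₀∈σ supp iw il int = subst IsInt
  (solve 2 (λ x y → x :+ y :- x := y) refl ((1ℚ - wsum M) * f w₀) (∫ f M))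
  (int-- (integral₁ {M = (1ℚ - wsum M , w₀) ∷ M} uni (w₀∈σ ∷ supp)
      (solve 1 (λ x → con 1ℚ :- x :+ x := con 1ℚ) refl (wsum M))
      (lattice-lin (int-- int1 iw) (All.lookup lat w₀∈σ) il) int)
    (int-* (int-- int1 iw) (int w₀)))

null : ∀ {M : Measure A} → NonNeg M → ∫ (const 1ℚ) M ≡ 0ℚ → ∀ f → ∫ f M ≡ 0ℚ
null [] eq f = refl
null {M = (c , a) ∷ M} (p ∷ ps) eq f = trans
  (cong₂ _+_ (trans (cong (_* f a) (trans (sym (*-identityʳ c)) (sum-zeroˡ 0≤c*1 0≤rest eq))) (*-zeroˡ (f a)))
    (null ps (sum-zeroʳ 0≤c*1 0≤rest eq) f))
  (+-identityˡ 0ℚ)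
  where
  0≤c*1 = *-nonNeg p 0≤1
  0≤rest = ∫-nonNeg ps (All.universal (λ _ → 0≤1) M)

-- Divided by their mass, both measures express one point lying in two cells. The common face yields
-- a third expression, on vertices of both cells, and the affine independence of each cell
-- identifies it with either of the two.
cell-independent : ∀ {R : Point n → Set} {S σ τ M N} → IsTriangulation R S → σ ∈ S → τ ∈ S →
  NonNeg M → Supp (_∈ σ) M → NonNeg N → Supp (_∈ τ) N →
  wsum M ≡ wsum N → lin M ≡ lin N → M ≈ N
cell-independent {S = S} {σ} {τ} {M} {N} (ind , _ , _ , meet) σ∈S τ∈S pM sM pN sN w l
  with wsum M ℚₚ.≟ 0ℚ
-- Without mass there is nothing to divide by, but then both nonnegative measures are zero.
... | yes z = equal λ f → trans (null pM (trans (sym (wsum≡∫ M)) z) f)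
                (sym (null pN (trans (sym (wsum≡∫ N)) (trans (sym w) z)) f))
... | no nz = equal λ f → trans (undo f M)
    (trans (cong (m *_) (at (≈-trans (≈-sym K≈M) K≈N) f)) (sym (undo f N)))
  where
  m = wsum M
  0≤m : 0ℚ ≤ m
  0≤m = subst (0ℚ ≤_) (sym (wsum≡∫ M)) (∫-nonNeg pM (All.universal (λ _ → 0≤1) M))
  inv = inverse 0≤m nz
  k = proj₁ inv
  0≤k = proj₁ (proj₂ inv)
  m*k≡1 = proj₂ (proj₂ inv)
  undo : ∀ f K → ∫ f K ≡ m * ∫ f (scale k K)
  undo f K = sym (trans (cong (m *_) (∫-scale f k K)) (trans (sym (*-assoc m k _))
    (trans (cong (_* ∫ f K) m*k≡1) (*-identityˡ _))))
  unit : ∀ K → wsum K ≡ m → wsum (scale k K) ≡ 1ℚ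
  unit K eq = trans (wsum-scale k K) (trans (cong (k *_) eq) (trans (*-comm k m) m*k≡1))
  both : ∀ {ρ} {K : Measure (Point _)} → NonNeg K → Supp (_∈ ρ) K → All (λ w → 0ℚ ≤ proj₁ w × proj₂ w ∈ ρ) (scale k K)
  both p s = All.zip (scale-nonNeg {k = k} 0≤k p , scale-supp {k = k} s)
  lin≡ : lin (scale k N) ≡ lin (scale k M)
  lin≡ = trans (lin-scale k N) (trans (cong (k ·_) (sym l)) (sym (lin-scale k M)))
  x = lin (scale k M)
  common = meet σ τ σ∈S τ∈S x (_ , both pM sM , unit M refl , refl) (_ , both pN sN , unit N (sym w) , lin≡)
  K = proj₁ common
  sK = proj₂ (All.unzip (proj₁ (proj₂ common)))
  wK = proj₁ (proj₂ (proj₂ common))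
  lK = proj₂ (proj₂ (proj₂ common))
  K≈M : K ≈ scale k M
  K≈M = determined {M = K} {scale k M} (All.lookup ind σ∈S) (All.map proj₁ sK) (scale-supp {k = k} sM) (trans wK (sym (unit M refl))) lK
  K≈N : K ≈ scale k N
  K≈N = determined {M = K} {scale k N} (All.lookup ind τ∈S) (All.map proj₂ sK) (scale-supp {k = k} sN) (trans wK (sym (unit N (sym w)))) (trans lK (sym lin≡))

-- Integral functionals on tokens

fromℕ : ℕ → ℚ
fromℕ zero = 0ℚ
fromℕ (suc n) = 1ℚ + fromℕ n

int-fromℕ : ∀ n → IsInt (fromℕ n)
int-fromℕ zero = int0
int-fromℕ (suc n) = int-+ int1 (int-fromℕ n)

sumOver : {A : Set} → (A → ℚ) → List A → ℚ
sumOver g [] = 0ℚ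
sumOver g (x ∷ s) = g x + sumOver g s

sumOver-0 : ∀ {A : Set} (s : List A) → sumOver (const 0ℚ) s ≡ 0ℚ
sumOver-0 [] = refl
sumOver-0 (_ ∷ s) = trans (+-identityˡ _) (sumOver-0 s)

int-sumOver : ∀ {A : Set} {g : A → ℚ} → (∀ a → IsInt (g a)) → ∀ s → IsInt (sumOver g s)
int-sumOver int [] = int0
int-sumOver int (x ∷ s) = int-+ (int x) (int-sumOver int s)

sumOver-++ : ∀ {A : Set} (g : A → ℚ) xs ys → sumOver g (xs ++ ys) ≡ sumOver g xs + sumOver g ys
sumOver-++ g [] ys = sym (+-identityˡ _)
sumOver-++ g (x ∷ xs) ys = trans (cong (g x +_) (sumOver-++ g xs ys)) (sym (+-assoc (g x) _ _))

-- Integrality is part of the data so that the same functionals serve affine independence and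
-- unimodularity.
record Functional (V W : Set) : Set where
  field
    onV : V → ℚ
    onW : W → ℚ
    onV-int : ∀ v → IsInt (onV v)
    onW-int : ∀ w → IsInt (onW w)
open Functional

value : ∀ {V W} → Functional V W → V × List W → ℚ
value h (v , s) = onV h v + sumOver (onW h) s

unitF : ∀ {V W} → Functional V W
unitF = record { onV = const 1ℚ ; onW = const 0ℚ ; onV-int = λ _ → int1 ; onW-int = λ _ → int0 }

value-unit : ∀ {V W} (t : V × List W) → value unitF t ≡ 1ℚ
value-unit (v , s) = trans (cong (_+_ 1ℚ) (sumOver-0 s)) (+-identityʳ 1ℚ)

-- Words over a totally ordered alphabet

module Words {W : Set} {_≤ʷ_ : Rel W 0ℓ} (ord : IsDecTotalOrder _≡_ _≤ʷ_) where
  open IsDecTotalOrder ord using (_≟_; _≤?_; total; antisym)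
    renaming (refl to ≤ʷ-refl; trans to ≤ʷ-trans; reflexive to ≤ʷ-reflexive)

  infix 4 _≼_
  -- Letters are compared only up to the length of the shorter word. Hence the empty word is below
  -- and above every word, and the relation is not transitive.
  data _≼_ : List W → List W → Set where
    []ˡ : ∀ {s} → [] ≼ s
    []ʳ : ∀ {s} → s ≼ []
    _∷_ : ∀ {x y s t} → x ≤ʷ y → s ≼ t → x ∷ s ≼ y ∷ t

  -- Each letter is compared with its successor. The same shift by one occurs in the interlacing
  -- condition of `_⊴_`.
  Sorted : List W → Set
  Sorted s = s ≼ drop 1 s

  ≼-refl : ∀ s → s ≼ s
  ≼-refl [] = []ˡ
  ≼-refl (x ∷ s) = ≤ʷ-refl ∷ ≼-refl s

  sorted-tail : ∀ {x s} → Sorted (x ∷ s) → Sorted s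
  sorted-tail {s = []} _ = []ˡ
  sorted-tail {s = _ ∷ _} (_ ∷ r) = r

  ≼-dec : ∀ s t → Dec (s ≼ t)
  ≼-dec [] t = yes []ˡ
  ≼-dec (x ∷ s) [] = yes []ʳ
  ≼-dec (x ∷ s) (y ∷ t) with x ≤? y | ≼-dec s t
  ... | yes p | yes q = yes (p ∷ q)
  ... | no ¬p | _ = no λ { (p ∷ _) → ¬p p }
  ... | _ | no ¬q = no λ { (_ ∷ q) → ¬q q }

  -- The letter `x` and the position `m` of the first difference are the data from which
  -- `separate-W` builds its functional.
  data First (x : W) : ℕ → List W → List W → Set where
    here : ∀ {y s t} → ¬ (y ≤ʷ x) → First x 0 (x ∷ s) (y ∷ t)
    there : ∀ {c m s t} → First x m s t → First x (suc m) (c ∷ s) (c ∷ t)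

  first : ∀ s t → length s ≡ length t → s ≢ t →
    (∃₂ λ x m → First x m s t) ⊎ (∃₂ λ x m → First x m t s)
  first [] [] _ ne = ⊥-elim (ne refl)
  first (x ∷ s) (y ∷ t) eq ne with x ≤? y | y ≤? x
  ... | _ | no y≰x = inj₁ (x , 0 , here y≰x)
  ... | no x≰y | _ = inj₂ (y , 0 , here x≰y)
  ... | yes x≤y | yes y≤x with antisym x≤y y≤x
  ...   | refl with first s t (cong ℕ.pred eq) (ne ∘ cong (x ∷_))
  ...     | inj₁ (z , m , d) = inj₁ (z , suc m , there d)
  ...     | inj₂ (z , m , d) = inj₂ (z , suc m , there d)

  below : W → W → ℚ
  below x w = if does (w ≤? x) then 1ℚ else 0ℚ

  int-below : ∀ x w → IsInt (below x w)
  int-below x w with w ≤? x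
  ... | yes _ = int1
  ... | no _ = int0

  below-yes : ∀ {x w} → w ≤ʷ x → below x w ≡ 1ℚ
  below-yes {x} {w} p with w ≤? x
  ... | yes _ = refl
  ... | no ¬p = ⊥-elim (¬p p)

  below-no : ∀ {x w} → ¬ (w ≤ʷ x) → below x w ≡ 0ℚ
  below-no {x} {w} ¬p with w ≤? x
  ... | yes p = ⊥-elim (¬p p)
  ... | no _ = refl

  0≤below : ∀ x w → 0ℚ ≤ below x w
  0≤below x w with w ≤? x
  ... | yes _ = 0≤1
  ... | no _ = ≤-refl

  below≤1 : ∀ x w → below x w ≤ 1ℚ
  below≤1 x w with w ≤? x
  ... | yes _ = ≤-refl
  ... | no _ = 0≤1

  count : W → List W → ℚ
  count x = sumOver (below x)

  0≤count : ∀ x s → 0ℚ ≤ count x s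
  0≤count x [] = ≤-refl
  0≤count x (w ∷ s) = +-nonNeg (0≤below x w) (0≤count x s)

  none : ∀ {x y} s → Sorted (y ∷ s) → ¬ (y ≤ʷ x) → count x (y ∷ s) ≡ 0ℚ
  none [] _ y≰x = trans (cong (_+ 0ℚ) (below-no y≰x)) (+-identityʳ 0ℚ)
  none (z ∷ s) (y≤z ∷ srt) y≰x =
    trans (cong₂ _+_ (below-no y≰x) (none s srt (y≰x ∘ ≤ʷ-trans y≤z))) (+-identityʳ 0ℚ)

  first-head : ∀ {x m c s t} → First x m (c ∷ s) t → Sorted (c ∷ s) → c ≤ʷ x
  first-head (here _) _ = ≤ʷ-refl
  first-head (there d@(here _)) (c≤ ∷ _) = c≤
  first-head (there d@(there _)) (c≤ ∷ srt) = ≤ʷ-trans c≤ (first-head d srt)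

  first-length : ∀ {x m s t} → First x m s t → m ℕ.≤ length s
  first-length (here _) = ℕ.z≤n
  first-length (there d) = ℕ.s≤s (first-length d)

  -- The letter `x` stands at position `m`, counted from 0, of a sorted word, so it counts together
  -- with the `m` letters before it.
  count-first-≥ : ∀ {x m s t} → First x m s t → Sorted s → fromℕ (suc m) ≤ count x s
  count-first-≥ {x} {s = _ ∷ s} (here _) srt =
    +-mono-≤ (≤-reflexive (sym (below-yes ≤ʷ-refl))) (0≤count x s)
  count-first-≥ (there d) srt =
    +-mono-≤ (≤-reflexive (sym (below-yes (first-head (there d) srt)))) (count-first-≥ d (sorted-tail srt))

  -- At position `m` the word `t` already exceeds `x`, and interlacing carries this over to position
  -- `m + 1` of `s`. Only the letters before that can count.
  count-first-≤ : ∀ {x m s t} → First x m s t → Sorted s → t ≼ drop 1 s → count x s ≤ fromℕ (suc m)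
  count-first-≤ {x} {s = _ ∷ []} (here _) _ _ = +-monoˡ-≤ 0ℚ (below≤1 x x)
  count-first-≤ {x} {s = _ ∷ _ ∷ s} (here y≰x) (_ ∷ srt) (y≤z ∷ _) =
    +-mono-≤ (below≤1 x x) (≤-reflexive (none s srt (y≰x ∘ ≤ʷ-trans y≤z)))
  count-first-≤ {x} {s = c ∷ _ ∷ _} (there d) srt (_ ∷ r) =
    +-mono-≤ (below≤1 x c) (count-first-≤ d (sorted-tail srt) r)

  -- For `i` less than `m`, letter `i` of `p` is bounded by letter `i + 1` of `s`, which stands at
  -- or before the place of `x`. The minimum allows for a word `p` shorter than `m`.
  count-≥ : ∀ {x m s t} → First x m s t → Sorted s → ∀ p → s ≼ p → p ≼ drop 1 s →
    fromℕ (m ⊓ length p) ≤ count x p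
  count-≥ {x} (here _) _ p _ _ = 0≤count x p
  count-≥ (there d) _ [] _ _ = ≤-refl
  count-≥ {x} {s = _ ∷ z ∷ s} (there d) srt (w ∷ p) (_ ∷ r₁) (w≤z ∷ r₂) =
    +-mono-≤ (≤-reflexive (sym (below-yes (≤ʷ-trans w≤z (first-head d (sorted-tail srt))))))
      (count-≥ d (sorted-tail srt) p r₁ r₂)

  -- From position `m` on, the sorted word `p` stays above the letter of `t` that exceeds `x`, so at
  -- most the first `m` letters count.
  count-≤ : ∀ {x m s t} → First x m s t → ∀ p → Sorted p → t ≼ p → count x p ≤ fromℕ (m ⊓ length p)
  count-≤ (here _) [] _ _ = ≤-refl
  count-≤ (here y≰x) (z ∷ p) srt (y≤z ∷ _) = ≤-reflexive (none p srt (y≰x ∘ ≤ʷ-trans y≤z))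
  count-≤ (there d) [] _ _ = ≤-refl
  count-≤ {x} (there d) (z ∷ p) srt (_ ∷ r) = +-mono-≤ (below≤1 x z) (count-≤ d p (sorted-tail srt) r)

-- Tokens

module Tokens {V W : Set} {_≤ᵛ_ : Rel V 0ℓ} {_≤ʷ_ : Rel W 0ℓ}
  (ordV : IsDecTotalOrder _≡_ _≤ᵛ_) (ordW : IsDecTotalOrder _≡_ _≤ʷ_) (ht : V → ℕ) where

  module OV = IsDecTotalOrder ordV
  module OW = IsDecTotalOrder ordW
  open Words ordW

  -- (v , s) stands for the point (v , Σ s) over the vertex v.
  Token : Set
  Token = V × List W

  Good : Token → Set
  Good (v , s) = length s ≡ ht v × Sorted s

  infix 4 _⊴_
  -- Not transitive: over a single vertex the words 12, 23, 34 interlace consecutively, but 12 and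
  -- 34 do not. This is why `Chain` asks for the relation between all pairs.
  _⊴_ : Token → Token → Set
  (v , s) ⊴ (v′ , s′) = (v′ ≤ᵛ v) × (s ≼ s′) × (s′ ≼ drop 1 s)

  ⊴-refl : ∀ {t} → Good t → t ⊴ t
  ⊴-refl {_ , s} (_ , srt) = OV.refl , ≼-refl s , srt

  -- The bounds `≥1`, `nonNeg` and `nonPos` tell apart two chains headed by `t` and `t′`. With `≤1`
  -- the value at `t` becomes exactly 1 when `t′` follows `t` in one chain.
  record Separated (t t′ : Token) : Set where
    field
      h : Functional V W
      ≥1 : 1ℚ ≤ value h t
      nonNeg : ∀ p → Good p → t ⊴ p → 0ℚ ≤ value h p
      nonPos : ∀ p → Good p → t′ ⊴ p → value h p ≤ 0ℚ
      ≤1 : t ⊴ t′ → value h t ≤ 1ℚ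

  above : V → V → ℚ
  above v u = if does (v OV.≤? u) then 1ℚ else 0ℚ

  -- The indicator of the vertices at or above `v` works: a token following `(v′ , s′)` has its
  -- vertex at or below `v′`, so it cannot be at or above `v`.
  separate-V : ∀ {v v′ s s′} → ¬ (v ≤ᵛ v′) → Separated (v , s) (v′ , s′)
  separate-V {v} {v′} {s} v≰v′ = record
    { h = h
    ; ≥1 = ≤-reflexive (sym (trans (val (v , s)) (above-self)))
    ; nonNeg = λ p _ _ → ≤-trans (0≤above (proj₁ p)) (≤-reflexive (sym (val p)))
    ; nonPos = λ p _ r → ≤-reflexive (trans (val p) (above-no (λ v≤ → v≰v′ (OV.trans v≤ (proj₁ r)))))
    ; ≤1 = λ _ → ≤-reflexive (trans (val (v , s)) above-self)
    }
    where
    int-above : ∀ u → IsInt (above v u)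
    int-above u with v OV.≤? u
    ... | yes _ = int1
    ... | no _ = int0
    0≤above : ∀ u → 0ℚ ≤ above v u
    0≤above u with v OV.≤? u
    ... | yes _ = 0≤1
    ... | no _ = ≤-refl
    above-no : ∀ {u} → ¬ (v ≤ᵛ u) → above v u ≡ 0ℚ
    above-no {u} ¬p with v OV.≤? u
    ... | yes p = ⊥-elim (¬p p)
    ... | no _ = refl
    above-self : above v v ≡ 1ℚ
    above-self with v OV.≤? v
    ... | yes _ = refl
    ... | no ¬p = ⊥-elim (¬p OV.refl)
    h : Functional V W
    h = record { onV = above v ; onW = const 0ℚ ; onV-int = int-above ; onW-int = λ _ → int0 }
    val : ∀ t → value h t ≡ above v (proj₁ t)
    val (u , r) = trans (cong (above v u +_) (sumOver-0 r)) (+-identityʳ _)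

  -- The functional counts the letters up to `x` and subtracts `m`, cut off at the height of the
  -- vertex. By `count-≥` and `count-≤`, tokens following `(v , s)` have at least that many such
  -- letters, tokens following `(v , s′)` at most that many.
  separate-W : ∀ {v s s′ x m} → Good (v , s) → First x m s s′ → Separated (v , s) (v , s′)
  separate-W {v} {s} {s′} {x} {m} (len , srt) d = record
    { h = h
    ; ≥1 = ≤-trans (≤-reflexive eq1) (+-mono-≤ at-v (count-first-≥ d srt))
    ; nonNeg = λ { (u , p) (lp , sp) (_ , r₁ , r₂) → ≤-trans
        (≤-reflexive (sym (+-inverseˡ (fromℕ (m ⊓ ht u)))))
        (+-monoʳ-≤ (- fromℕ (m ⊓ ht u))
          (subst (λ l → fromℕ (m ⊓ l) ≤ count x p) lp (count-≥ d srt p r₁ r₂))) }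
    ; nonPos = λ { (u , p) (lp , sp) (_ , r₁ , r₂) → ≤-trans
        (+-monoʳ-≤ (- fromℕ (m ⊓ ht u))
          (subst (λ l → count x p ≤ fromℕ (m ⊓ l)) lp (count-≤ d p sp r₁)))
        (≤-reflexive (+-inverseˡ (fromℕ (m ⊓ ht u)))) }
    ; ≤1 = λ { (_ , _ , r) → ≤-trans
        (+-mono-≤ at-v′ (count-first-≤ d srt r)) (≤-reflexive (sym eq1)) }
    }
    where
    h : Functional V W
    h = record { onV = λ u → - fromℕ (m ⊓ ht u) ; onW = below x
               ; onV-int = λ u → int-neg (int-fromℕ (m ⊓ ht u)) ; onW-int = int-below x }
    -- The first difference lies within the word, so the cut-off has no effect at `v` itself.
    m≡ : m ≡ m ⊓ ht v
    m≡ = sym (ℕₚ.m≤n⇒m⊓n≡m (subst (m ℕ.≤_) len (first-length d)))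
    at-v : - fromℕ m ≤ - fromℕ (m ⊓ ht v)
    at-v = ≤-reflexive (cong (λ k → - fromℕ k) m≡)
    at-v′ : - fromℕ (m ⊓ ht v) ≤ - fromℕ m
    at-v′ = ≤-reflexive (cong (λ k → - fromℕ k) (sym m≡))
    eq1 : 1ℚ ≡ - fromℕ m + fromℕ (suc m)
    eq1 = solve 1 (λ y → con 1ℚ := :- y :+ (con 1ℚ :+ y)) refl (fromℕ m)

  -- If the vertices differ, antisymmetry makes one comparison fail. If they agree, the words have
  -- equal length, and the one with the smaller letter at the first difference is separated from the
  -- other.
  separate : ∀ {t t′} → Good t → Good t′ → t ≢ t′ → Separated t t′ ⊎ Separated t′ t
  separate {v , s} {v′ , s′} g g′ t≢t′ with v OV.≤? v′ | v′ OV.≤? v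
  ... | no v≰v′ | _ = inj₁ (separate-V v≰v′)
  ... | _ | no v′≰v = inj₂ (separate-V v′≰v)
  ... | yes v≤v′ | yes v′≤v with OV.antisym v≤v′ v′≤v
  ...   | refl with first s s′ (trans (proj₁ g) (sym (proj₁ g′))) (t≢t′ ∘ cong (v ,_))
  ...     | inj₁ (_ , _ , d) = inj₁ (separate-W g d)
  ...     | inj₂ (_ , _ , d) = inj₂ (separate-W g′ d)

  -- Chains of tokens and their coefficients

  Chain : List Token → Set
  Chain ts = All Good ts × AllPairs (λ t t′ → (t ⊴ t′) × t ≢ t′) ts

  chain-tail : ∀ {t ts} → Chain (t ∷ ts) → Chain ts
  chain-tail (_ ∷ gs , _ ∷ ps) = gs , ps

  record HeadFunctional (t : Token) (ts : List Token) : Set where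
    field
      h : Functional V W
      one : value h t ≡ 1ℚ
      zeros : All (λ p → value h p ≡ 0ℚ) ts

  -- It suffices to separate the first token from the second. Every later token follows both, so the
  -- functional is nonnegative and nonpositive there.
  head-functional : ∀ {t ts} → Chain (t ∷ ts) → HeadFunctional t ts
  head-functional {t} {[]} _ = record { h = unitF ; one = value-unit t ; zeros = [] }
  head-functional {t} {t′ ∷ ts} (g ∷ g′ ∷ gs , ((t⊴t′ , t≢t′) ∷ rs) ∷ (rs′ ∷ _)) with separate g g′ t≢t′
  -- The reverse separation is impossible: it would be at least 1 at `t′`, and at most 0 there
  -- because `t′` follows `t`.
  ... | inj₂ sep = ⊥-elim (1≢0 (≤-antisym (≤-trans (Separated.≥1 sep) (Separated.nonPos sep t′ g′ t⊴t′)) 0≤1))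
  ... | inj₁ sep = record
    { h = h
    ; one = ≤-antisym (≤1 t⊴t′) ≥1
    ; zeros = ≤-antisym (nonPos t′ g′ (⊴-refl g′)) (nonNeg t′ g′ t⊴t′) ∷
        All.map (λ { ((gp , t⊴p , _) , (t′⊴p , _)) → ≤-antisym (nonPos _ gp t′⊴p) (nonNeg _ gp t⊴p) })
          (All.zip (All.zip (gs , rs) , rs′))
    }
    where open Separated sep

  ∫-null : ∀ {A : Set} {f : A → ℚ} {M} → Supp (λ a → f a ≡ 0ℚ) M → ∫ f M ≡ 0ℚ
  ∫-null [] = refl
  ∫-null {M = (c , _) ∷ _} (e ∷ es) = trans (cong₂ _+_ (trans (cong (c *_) e) (*-zeroʳ c)) (∫-null es)) (+-identityʳ 0ℚ)

  zip-All : ∀ {A : Set} {R : A → Set} (ls : List ℚ) {as} → All R as → Supp R (zip ls as)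
  zip-All [] _ = []
  zip-All (_ ∷ ls) [] = []
  zip-All (_ ∷ ls) (r ∷ rs) = r ∷ zip-All ls rs

  -- The head functional isolates the first coefficient; its contribution is then subtracted, and
  -- the argument repeats on the tail. Affine independence takes `D` to be vanishing, unimodularity
  -- takes it to be integrality.
  coefficients : ∀ (D : ℚ → Set) → (∀ {p q} → D p → D q → D (p - q)) → (∀ {p z} → D p → IsInt z → D (p * z)) →
    ∀ {ts ls} → Chain ts → length ls ≡ length ts → (∀ h → D (∫ (value h) (zip ls ts))) → All D ls
  coefficients D D-- D-* {[]} {[]} ch len ints = []
  coefficients D D-- D-* {t ∷ ts} {c ∷ ls} ch len ints =
    Dc ∷ coefficients D D-- D-* (chain-tail ch) (cong ℕ.pred len)
      λ k → subst D (solve 2 (λ x y → x :+ y :- x := y) refl (c * value k t) (∫ (value k) (zip ls ts)))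
        (D-- (ints k) (D-* Dc (int-+ (onV-int k (proj₁ t)) (int-sumOver (onW-int k) (proj₂ t)))))
    where
    open HeadFunctional (head-functional ch)
    Dc : D c
    Dc = subst D (trans (cong₂ _+_ (trans (cong (c *_) one) (*-identityʳ c)) (∫-null (zip-All ls zeros))) (+-identityʳ c)) (ints h)

  tokens : Measure Token → List Token
  tokens = map proj₂

  -- The separating functional integrates to at least `c` on the left and to at most 0 on the right.
  conflict : ∀ {t t′ c M N} → Separated t t′ → 0ℚ ≤ c → c ≢ 0ℚ → NonNeg M → NonNeg N →
    Supp Good M → Supp Good N → Supp (t ⊴_) M → Supp (t′ ⊴_) N →
    ¬ (∀ h → ∫ (value h) ((c , t) ∷ M) ≡ ∫ (value h) N)
  conflict {t} {c = c} {M} {N} sep 0≤c c≢0 nM nN gM gN rM rN eq = c≢0 (≤-antisym c≤0 0≤c)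
    where
    open Separated sep
    c≤0 : c ≤ 0ℚ
    c≤0 = ≤-trans (≤-reflexive (sym (trans (+-identityʳ (c * 1ℚ)) (*-identityʳ c)))) (≤-trans
      (+-mono-≤ (*-monoˡ-≤-nonNeg c {{nonNegative 0≤c}} ≥1)
        (∫-nonNeg nM (All.map (λ { (g , r) → nonNeg _ g r }) (All.zip (gM , rM)))))
      (≤-trans (≤-reflexive (eq h))
        (∫-nonPos nN (All.map (λ { (g , r) → nonPos _ g r }) (All.zip (gN , rN))))))

  _≟ᵗ_ : (t t′ : Token) → Dec (t ≡ t′)
  _≟ᵗ_ = Product.≡-dec OV._≟_ (≡-dec OW._≟_)

  drop-zero : ∀ {c} x y → c ≡ 0ℚ → c * x + y ≡ y
  drop-zero x y refl = trans (cong (_+ y) (*-zeroˡ x)) (+-identityˡ y)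

  peelˡ : ∀ c c′ x y z → c * x + y ≡ c′ * x + z → y ≡ (c′ - c) * x + z
  peelˡ c c′ x y z e = begin
    y ≡⟨ solve 3 (λ c x y → y := c :* x :+ y :- c :* x) refl c x y ⟩
    c * x + y - c * x ≡⟨ cong (_- c * x) e ⟩
    c′ * x + z - c * x ≡⟨ solve 4 (λ c c′ x z → c′ :* x :+ z :- c :* x := (c′ :- c) :* x :+ z) refl c c′ x z ⟩
    (c′ - c) * x + z ∎

  unpeel : ∀ c c′ x y → c′ * x + ((c - c′) * x + y) ≡ c * x + y
  unpeel = solve 4 (λ c c′ x y → c′ :* x :+ ((c :- c′) :* x :+ y) := c :* x :+ y) refl

  Common : Measure Token → Measure Token → Set
  Common M N = ∃ λ K → K ≈ M × NonNeg K × Supp (λ t → t ∈ tokens M × t ∈ tokens N) K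

  SameValues : Measure Token → Measure Token → Set
  SameValues M N = ∀ h → ∫ (value h) M ≡ ∫ (value h) N

  -- By `⊴-refl` each head counts among the tokens following itself. So, whichever way distinct
  -- heads are separated, `conflict` applies, with the other head included in its measure.
  heads-agree : ∀ {t t′ c c′ M N} → Chain (t ∷ tokens M) → Chain (t′ ∷ tokens N) →
    0ℚ ≤ c → 0ℚ ≤ c′ → c ≢ 0ℚ → c′ ≢ 0ℚ → NonNeg M → NonNeg N →
    SameValues ((c , t) ∷ M) ((c′ , t′) ∷ N) → t ≡ t′
  heads-agree {t} {t′} {c} {c′} {M} {N} (gt ∷ gM , rM ∷ _) (gt′ ∷ gN , rN ∷ _) 0≤c 0≤c′ c≢0 c′≢0 nM nN eq
    with t ≟ᵗ t′
  ... | yes t≡t′ = t≡t′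
  ... | no t≢t′ = ⊥-elim (differ (separate gt gt′ t≢t′))
    where
    differ : ¬ (Separated t t′ ⊎ Separated t′ t)
    differ (inj₁ sep) = conflict sep 0≤c c≢0 nM (0≤c′ ∷ nN) (Allₚ.map⁻ gM) (gt′ ∷ Allₚ.map⁻ gN)
      (Allₚ.map⁻ (All.map proj₁ rM)) (⊴-refl gt′ ∷ Allₚ.map⁻ (All.map proj₁ rN)) eq
    differ (inj₂ sep) = conflict sep 0≤c′ c′≢0 nN (0≤c ∷ nM) (Allₚ.map⁻ gN) (gt ∷ Allₚ.map⁻ gM)
      (Allₚ.map⁻ (All.map proj₁ rN)) (⊴-refl gt ∷ Allₚ.map⁻ (All.map proj₁ rM)) (λ h → sym (eq h))

  common-dropˡ : ∀ {c t M N} → c ≡ 0ℚ → Common M N → Common ((c , t) ∷ M) N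
  common-dropˡ {c} {t} {M} c≡0 (K , K≈M , nK , sK) =
    K , equal (λ f → trans (at K≈M f) (sym (drop-zero (f t) (∫ f M) c≡0))) , nK , All.map (map₁ there) sK

  common-peelˡ : ∀ {c c′ t M N} → 0ℚ ≤ c → Common M ((c′ - c , t) ∷ N) → Common ((c , t) ∷ M) ((c′ , t) ∷ N)
  common-peelˡ {c} {t = t} 0≤c (K , K≈M , nK , sK) =
    (c , t) ∷ K , equal (λ f → cong (c * f t +_) (at K≈M f)) , 0≤c ∷ nK , (here refl , here refl) ∷ All.map (map₁ there) sK

  common-peelʳ : ∀ {c c′ t M N} → 0ℚ ≤ c′ → Common ((c - c′ , t) ∷ M) N → Common ((c , t) ∷ M) ((c′ , t) ∷ N)
  common-peelʳ {c} {c′} {t} {M} 0≤c′ (K , K≈M , nK , sK) =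
    (c′ , t) ∷ K , equal (λ f → trans (cong (c′ * f t +_) (at K≈M f)) (unpeel c c′ (f t) (∫ f M))) ,
    0≤c′ ∷ nK , (here refl , here refl) ∷ All.map (map₂ there) sK

  -- The common part of two chains is peeled off from the heads, which agree because otherwise a
  -- separating functional would tell the two measures apart.
  common : ∀ n M N → length M ℕ.+ length N ℕ.≤ n → Chain (tokens M) → Chain (tokens N) →
    NonNeg M → NonNeg N → SameValues M N → Common M N
  common n [] N _ _ _ _ _ _ = [] , equal (λ _ → refl) , [] , []
  -- The unit functional shows that `M` has no mass, so the empty measure represents it.
  common n M@(_ ∷ _) [] _ _ _ nM _ eq = [] , equal (λ f → sym (null nM mass f)) , [] , []
    where
    mass : ∫ (const 1ℚ) M ≡ 0ℚ
    mass = trans (sym (∫-cong M (All.universal (λ w → value-unit (proj₂ w)) M))) (eq unitF)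
  common (suc n) ((c , t) ∷ M) ((c′ , t′) ∷ N) (ℕ.s≤s le) chM chN (0≤c ∷ nM) (0≤c′ ∷ nN) eq =
    split (c ℚₚ.≟ 0ℚ) (c′ ℚₚ.≟ 0ℚ)
    where
    le′ : suc (length M) ℕ.+ length N ℕ.≤ n
    le′ = subst (ℕ._≤ n) (ℕₚ.+-suc (length M) (length N)) le
    -- The smaller head weight goes to the common part. Its entry is removed, the other head keeps
    -- the difference, and the total length drops by one.
    peel : ∀ {t″} → t ≡ t″ → c ≤ c′ ⊎ c′ ≤ c → Chain (t″ ∷ tokens N) →
      SameValues ((c , t) ∷ M) ((c′ , t″) ∷ N) → Common ((c , t) ∷ M) ((c′ , t″) ∷ N)
    peel refl (inj₁ c≤c′) chN eq = common-peelˡ {c} {c′} {t} {M} {N} 0≤c (common n M ((c′ - c , t) ∷ N) le (chain-tail chM) chN nM (≤⇒0≤- c≤c′ ∷ nN)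
      (λ h → peelˡ c c′ (value h t) (∫ (value h) M) (∫ (value h) N) (eq h)))
    peel refl (inj₂ c′≤c) chN eq = common-peelʳ {M = M} {N} 0≤c′ (common n ((c - c′ , t) ∷ M) N le′ chM (chain-tail chN) (≤⇒0≤- c′≤c ∷ nM) nN
      (λ h → sym (peelˡ c′ c (value h t) (∫ (value h) N) (∫ (value h) M) (sym (eq h)))))
    split : Dec (c ≡ 0ℚ) → Dec (c′ ≡ 0ℚ) → Common ((c , t) ∷ M) ((c′ , t′) ∷ N)
    split (yes c≡0) _ = common-dropˡ {M = M} {(c′ , t′) ∷ N} c≡0 (common n M ((c′ , t′) ∷ N) le (chain-tail chM) chN nM (0≤c′ ∷ nN)
      (λ h → trans (sym (drop-zero (value h t) (∫ (value h) M) c≡0)) (eq h)))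
    split (no _) (yes c′≡0) with common n ((c , t) ∷ M) N le′ chM (chain-tail chN) (0≤c ∷ nM) nN
      (λ h → trans (eq h) (drop-zero (value h t′) (∫ (value h) N) c′≡0))
    ... | K , K≈M , nK , sK = K , K≈M , nK , All.map (map₂ there) sK
    split (no c≢0) (no c′≢0) =
      peel (heads-agree {M = M} {N} chM chN 0≤c 0≤c′ c≢0 c′≢0 nM nN eq) (≤-total c c′) chN eq

-- Filling rows with letters

module Filling {W : Set} {_≤ʷ_ : Rel W 0ℓ} (ord : IsDecTotalOrder _≡_ _≤ʷ_) where
  open Words ord

  Row : Set
  Row = List W

  Empty : Row → Set
  Empty r = r ≡ []

  Interlaced : Row → Row → Set
  Interlaced s s′ = (s ≼ s′) × (s′ ≼ drop 1 s)

  total-length : List ℕ → ℕ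
  total-length [] = 0
  total-length (h ∷ hs) = h ℕ.+ total-length hs

  Decreasing : List ℕ → Set
  Decreasing = AllPairs ℕ._≥_

  -- In a decreasing list the positive heights come first, so this is the length of the first
  -- column.
  width : List ℕ → ℕ
  width [] = 0
  width (zero ∷ hs) = 0
  width (suc h ∷ hs) = suc (width hs)

  zeros-pred : ∀ {hs} → All (0 ℕ.≥_) hs → map ℕ.pred hs ≡ hs
  zeros-pred [] = refl
  zeros-pred (ℕ.z≤n ∷ zs) = cong (0 ∷_) (zeros-pred zs)

  pred-decreasing : ∀ {hs} → Decreasing hs → Decreasing (map ℕ.pred hs)
  pred-decreasing ds = AllPairs.map⁺ (AllPairs.map ℕₚ.pred-mono-≤ ds)

  total-width : ∀ {hs} → Decreasing hs → total-length hs ≡ width hs ℕ.+ total-length (map ℕ.pred hs)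
  total-width [] = refl
  total-width {zero ∷ hs} (zs ∷ ds) = cong total-length (sym (zeros-pred zs))
  total-width {suc h ∷ hs} (_ ∷ ds) = cong suc (trans (cong (h ℕ.+_) (total-width ds))
    (trans (sym (ℕₚ.+-assoc h (width hs) _)) (trans (cong (ℕ._+ total-length (map ℕ.pred hs)) (ℕₚ.+-comm h (width hs)))
      (ℕₚ.+-assoc (width hs) h _))))

  prepend : List W → List Row → List Row
  prepend [] rows = rows
  prepend (x ∷ xs) [] = []
  prepend (x ∷ xs) (r ∷ rows) = (x ∷ r) ∷ prepend xs rows

  prepend-length : ∀ {hs} xs rows → Decreasing hs → length xs ≡ width hs →
    map length rows ≡ map ℕ.pred hs → map length (prepend xs rows) ≡ hs
  prepend-length {[]} [] rows _ _ eq = eq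
  prepend-length {zero ∷ hs} [] rows (zs ∷ _) _ eq = trans eq (cong (0 ∷_) (zeros-pred zs))
  prepend-length {suc h ∷ hs} (x ∷ xs) (r ∷ rows) (_ ∷ ds) len eq = cong₂ _∷_
    (cong suc (Listₚ.∷-injectiveˡ eq)) (prepend-length xs rows ds (cong ℕ.pred len) (Listₚ.∷-injectiveʳ eq))

  prepend-sum : ∀ {hs} g xs rows → length xs ≡ width hs → map length rows ≡ map ℕ.pred hs →
    sumOver (sumOver g) (prepend xs rows) ≡ sumOver g xs + sumOver (sumOver g) rows
  prepend-sum g [] rows _ _ = sym (+-identityˡ _)
  prepend-sum {suc h ∷ hs} g (x ∷ xs) (r ∷ rows) len eq = trans
    (cong (g x + sumOver g r +_) (prepend-sum {hs} g xs rows (cong ℕ.pred len) (Listₚ.∷-injectiveʳ eq)))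
    (solve 4 (λ a b c d → a :+ b :+ (c :+ d) := a :+ c :+ (b :+ d)) refl
      (g x) (sumOver g r) (sumOver g xs) (sumOver (sumOver g) rows))

  prepend-All : ∀ {P : W → Set} xs rows → All P xs → All (All P) rows → All (All P) (prepend xs rows)
  prepend-All [] rows _ ps = ps
  prepend-All (x ∷ xs) [] _ _ = []
  prepend-All (x ∷ xs) (r ∷ rows) (q ∷ qs) (p ∷ ps) = (q ∷ p) ∷ prepend-All xs rows qs ps

  empty-rows : ∀ {hs} (rows : List Row) → Decreasing hs → 0 ≡ width hs → map length rows ≡ map ℕ.pred hs → All Empty rows
  empty-rows {[]} [] _ _ _ = []
  empty-rows {zero ∷ hs} rows (zs ∷ _) _ eq = go rows (ℕ.z≤n ∷ zs) eq
    where
    go : ∀ {hs} (rows : List Row) → All (0 ℕ.≥_) hs → map length rows ≡ map ℕ.pred hs → All Empty rows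
    go [] _ _ = []
    go ([] ∷ rows) (_ ∷ zs) eq = refl ∷ go rows zs (Listₚ.∷-injectiveʳ eq)
    go ((_ ∷ _) ∷ rows) (ℕ.z≤n ∷ zs) ()

  -- The second interlacing condition now compares `y ∷ r′` with `r`: the head needs `y` to be at
  -- most the first letter of `r`, and the remainder is the old second condition.
  interlaced-∷ : ∀ {x y r r′} → x ≤ʷ y → All (y ≤ʷ_) r → Interlaced r r′ → Interlaced (x ∷ r) (y ∷ r′)
  interlaced-∷ x≤y [] (a , b) = x≤y ∷ a , []ʳ
  interlaced-∷ x≤y (y≤z ∷ _) (a , b) = x≤y ∷ a , y≤z ∷ b

  sorted-∷ : ∀ {x r} → All (x ≤ʷ_) r → Sorted r → Sorted (x ∷ r)
  sorted-∷ [] _ = []ʳ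
  sorted-∷ (x≤z ∷ _) srt = x≤z ∷ srt

  prepend-sorted : ∀ xs rows → All (λ x → All (All (x ≤ʷ_)) rows) xs → All Sorted rows → All Sorted (prepend xs rows)
  prepend-sorted [] rows _ srt = srt
  prepend-sorted (x ∷ xs) [] _ _ = []
  prepend-sorted (x ∷ xs) (r ∷ rows) ((b ∷ _) ∷ bs) (srt ∷ srts) =
    sorted-∷ b srt ∷ prepend-sorted xs rows (All.map All.tail bs) srts

  prepend-interlaced-head : ∀ {hs x r} xs rows → Decreasing hs → length xs ≡ width hs → map length rows ≡ map ℕ.pred hs →
    All (x ≤ʷ_) xs → All (λ y → All (y ≤ʷ_) r) xs → All (Interlaced r) rows → All (Interlaced (x ∷ r)) (prepend xs rows)
  -- Below the end of the column only empty rows remain, and these interlace with anything.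
  prepend-interlaced-head [] rows ds len eq _ _ _ = All.map (λ { refl → []ʳ , []ˡ }) (empty-rows rows ds len eq)
  prepend-interlaced-head (y ∷ xs) [] _ _ _ _ _ _ = []
  prepend-interlaced-head {suc h ∷ hs} (y ∷ xs) (r ∷ rows) (_ ∷ ds) len eq (x≤y ∷ x≤) (y≤r ∷ ≤r) (i ∷ is) =
    interlaced-∷ x≤y y≤r i ∷ prepend-interlaced-head xs rows ds (cong ℕ.pred len) (Listₚ.∷-injectiveʳ eq) x≤ ≤r is

  prepend-interlaced : ∀ {hs} xs rows → Decreasing hs → length xs ≡ width hs → map length rows ≡ map ℕ.pred hs →
    AllPairs _≤ʷ_ xs → All (λ x → All (All (x ≤ʷ_)) rows) xs → AllPairs Interlaced rows → AllPairs Interlaced (prepend xs rows)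
  prepend-interlaced [] rows _ _ _ _ _ is = is
  prepend-interlaced (x ∷ xs) [] _ _ _ _ _ _ = []
  prepend-interlaced {suc h ∷ hs} (x ∷ xs) (r ∷ rows) (_ ∷ ds) len eq (x≤ ∷ asc) (_ ∷ bs) (i ∷ is) =
    prepend-interlaced-head xs rows ds (cong ℕ.pred len) (Listₚ.∷-injectiveʳ eq) x≤ (All.map All.head bs) i ∷
    prepend-interlaced xs rows ds (cong ℕ.pred len) (Listₚ.∷-injectiveʳ eq) asc (All.map All.tail bs) is

  -- Since `g` is arbitrary, `sums` records that each letter is used as often as it occurs in `ws`.
  record Filling (hs : List ℕ) (ws : List W) : Set where
    field
      rows : List Row
      lengths : map length rows ≡ hs
      interlaced : AllPairs Interlaced rows
      sorted : All Sorted rows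
      letters : All (All (_∈ ws)) rows
      sums : ∀ g → sumOver (sumOver g) rows ≡ sumOver g ws

  take-drop-≤ : ∀ k {ws} → AllPairs _≤ʷ_ ws → All (λ x → All (x ≤ʷ_) (drop k ws)) (take k ws)
  take-drop-≤ zero _ = []
  take-drop-≤ (suc k) [] = []
  take-drop-≤ (suc k) (x≤ ∷ asc) = Allₚ.drop⁺ k x≤ ∷ take-drop-≤ k asc

  -- The letters fill the rows column by column, so that consecutive columns cannot overlap.
  fill : ∀ n hs ws → Decreasing hs → All (ℕ._≤ n) hs → AllPairs _≤ʷ_ ws → length ws ≡ total-length hs → Filling hs ws
  -- The first argument bounds the number of columns. Without columns all rows are empty, and no
  -- letters are left.
  fill zero hs ws ds bound asc len = record
    { rows = map (const []) hs
    ; lengths = lens bound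
    ; interlaced = pairs hs
    ; sorted = Allₚ.map⁺ (All.universal (λ _ → []ˡ) hs)
    ; letters = Allₚ.map⁺ (All.universal (λ _ → []) hs)
    ; sums = λ g → trans (zero-sum g hs) (sym (cong (sumOver g) (no-letters {ws = ws} bound len)))
    }
    where
    lens : ∀ {hs} → All (ℕ._≤ 0) hs → map length (map (const []) hs) ≡ hs
    lens [] = refl
    lens (ℕ.z≤n ∷ bs) = cong (0 ∷_) (lens bs)
    pairs : ∀ hs → AllPairs Interlaced (map (const []) hs)
    pairs [] = []
    pairs (_ ∷ hs) = Allₚ.map⁺ (All.universal (λ _ → []ˡ , []ˡ) hs) ∷ pairs hs
    zero-sum : ∀ g hs → sumOver (sumOver g) (map (const []) hs) ≡ 0ℚ
    zero-sum g [] = refl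
    zero-sum g (_ ∷ hs) = trans (+-identityˡ _) (zero-sum g hs)
    no-letters : ∀ {hs ws} → All (ℕ._≤ 0) hs → length ws ≡ total-length hs → ws ≡ []
    no-letters {ws = []} _ _ = refl
    no-letters {ws = ws@(_ ∷ _)} (ℕ.z≤n ∷ bs) eq = no-letters {ws = ws} bs eq
  fill (suc n) hs ws ds bound asc len = record
    { rows = prepend xs rows
    ; lengths = prepend-length xs rows ds len-xs lengths
    ; interlaced = prepend-interlaced xs rows ds len-xs lengths (AllPairs.take⁺ k asc) low interlaced
    ; sorted = prepend-sorted xs rows low sorted
    ; letters = prepend-All xs rows (All.map (from-part ∈-++⁺ˡ) (All.tabulate id))
        (All.map (All.map (from-part (∈-++⁺ʳ xs))) letters)
    ; sums = λ g → trans (prepend-sum {hs} g xs rows len-xs lengths)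
        (trans (cong (sumOver g xs +_) (sums g)) (trans (sym (sumOver-++ g xs ys)) (cong (sumOver g) (take++drop≡id k ws))))
    }
    where
    k = width hs
    xs = take k ws
    ys = drop k ws
    total : length ws ≡ k ℕ.+ total-length (map ℕ.pred hs)
    total = trans len (total-width ds)
    len-xs : length xs ≡ k
    len-xs = trans (length-take k ws) (ℕₚ.m≤n⇒m⊓n≡m (subst (k ℕ.≤_) (sym total) (ℕₚ.m≤m+n k _)))
    len-ys : length ys ≡ total-length (map ℕ.pred hs)
    len-ys = trans (length-drop k ws) (trans (cong (ℕ._∸ k) total) (ℕₚ.m+n∸m≡n k _))
    from-part : ∀ {x} {part : List W} → (x ∈ part → x ∈ xs ++ ys) → x ∈ part → x ∈ ws
    from-part inj x∈ = subst (_ ∈_) (take++drop≡id k ws) (inj x∈)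
    open Filling (fill n (map ℕ.pred hs) ys (pred-decreasing ds) (Allₚ.map⁺ (All.map ℕₚ.pred-mono-≤ bound))
      (AllPairs.drop⁺ k asc) len-ys)
    -- The remaining rows draw their letters from `ys`, which comes after `xs` in the ascending
    -- list.
    low : All (λ x → All (All (x ≤ʷ_)) rows) xs
    low = All.map (λ x≤ → All.map (All.map (All.lookup x≤)) letters) (take-drop-≤ k asc)

-- Orders on points

-- Serves twice: along the identity it replaces pointwise by propositional equality of vectors, and
-- along a map that puts `φ v` in front of `v` it orders the vertices.
pull-order : ∀ {A B : Set} {_≋_ _⊑_ : Rel A 0ℓ} (f : B → A) → (∀ {x y} → f x ≋ f y → x ≡ y) →
  IsDecTotalOrder _≋_ _⊑_ → IsDecTotalOrder _≡_ (λ x y → f x ⊑ f y)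
pull-order f inj ord = record
  { isTotalOrder = record
    { isPartialOrder = record
      { isPreorder = record
        { isEquivalence = isEquivalence
        ; reflexive = λ { refl → O.refl }
        ; trans = O.trans
        }
      ; antisym = λ p q → inj (O.antisym p q)
      }
    ; total = λ x y → O.total (f x) (f y)
    }
  ; _≟_ = λ x y → Dec.map′ inj (λ { refl → O.Eq.refl }) (f x O.≟ f y)
  ; _≤?_ = λ x y → f x O.≤? f y
  }
  where module O = IsDecTotalOrder ord

lex-order : ∀ n → IsDecTotalOrder _≡_ (Lex.Lex-≤ _≡_ _≤_ {n} {n})
lex-order n = pull-order id Pointwise-≡⇒≡ (Lex.≤-isDecTotalOrder ℚₚ.≤-isDecTotalOrder)

lex-head : ∀ {x y} {u v : Vec ℚ n} → Lex.Lex-≤ _≡_ _≤_ (x Vec.∷ u) (y Vec.∷ v) → x ≤ y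
lex-head (this (x≤y , _) _) = x≤y
lex-head (next refl _) = ≤-refl

-- Finite enumerations

words : ℕ → List A → List (List A)
words zero L = [] ∷ []
words (suc n) L = [] ∷ cartesianProductWith _∷_ L (words n L)

words⁺ : ∀ {n L} {s : List A} → All (_∈ L) s → length s ℕ.≤ n → s ∈ words n L
words⁺ {n = zero} [] _ = here refl
words⁺ {n = suc n} [] _ = here refl
words⁺ {n = suc n} (x∈ ∷ s∈) (ℕ.s≤s le) = there (∈-cartesianProductWith⁺ _∷_ x∈ (words⁺ s∈ le))

words⁻ : ∀ n {L} {s : List A} → s ∈ words n L → All (_∈ L) s
words⁻ zero (here refl) = []
words⁻ (suc n) (here refl) = []
words⁻ (suc n) {L} (there s∈) with ∈-cartesianProductWith⁻ _∷_ L (words n L) s∈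
... | _ , _ , x∈ , t∈ , refl = x∈ ∷ words⁻ n t∈

-- Bounds the length of a chain by the number of available tokens, so that the chains can be
-- enumerated. Each step deletes one occurrence of `x` from `ys`, which loses no other element of
-- `xs`.
unique-length : ∀ {xs ys : List A} → AllPairs _≢_ xs → All (_∈ ys) xs → length xs ℕ.≤ length ys
unique-length [] _ = ℕ.z≤n
unique-length {xs = x ∷ xs} (x≢ ∷ uniq) (x∈ ∷ xs∈) with ∈-∃++ x∈
... | as , bs , refl = subst (suc (length xs) ℕ.≤_) (sym (trans (length-++ as) (ℕₚ.+-suc (length as) (length bs))))
    (ℕ.s≤s (subst (length xs ℕ.≤_) (length-++ as) (unique-length uniq (All.zipWith remove (x≢ , xs∈)))))
  where
  remove : ∀ {y} → (x ≢ y) × y ∈ as ++ x ∷ bs → y ∈ as ++ bs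
  remove (x≢y , y∈) with ∈-++⁻ as y∈
  ... | inj₁ y∈as = ∈-++⁺ˡ y∈as
  ... | inj₂ (here refl) = ⊥-elim (x≢y refl)
  ... | inj₂ (there y∈bs) = ∈-++⁺ʳ as y∈bs

AllPairs-deduplicate : ∀ {R : Rel A 0ℓ} (_≟_ : (x y : A) → Dec (x ≡ y)) {xs} →
  AllPairs R xs → AllPairs R (deduplicate _≟_ xs)
AllPairs-deduplicate _≟_ [] = []
AllPairs-deduplicate _≟_ {x ∷ xs} (r ∷ rs) =
  Allₚ.filter⁺ _ (All.tabulate (λ y∈ → All.lookup r (∈-deduplicate⁻ _≟_ xs y∈))) ∷
  AllPairs.filter⁺ _ (AllPairs-deduplicate _≟_ rs)

AllPairs-zip : ∀ {A B : Set} {R : Rel A 0ℓ} {S : Rel B 0ℓ} {xs ys} → AllPairs R xs → AllPairs S ys →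
  AllPairs (λ p q → R (proj₁ p) (proj₁ q) × S (proj₂ p) (proj₂ q)) (zip xs ys)
AllPairs-zip [] _ = []
AllPairs-zip (_ ∷ _) [] = []
AllPairs-zip (r ∷ rs) (s ∷ ss) = All-zip r s ∷ AllPairs-zip rs ss
  where
  All-zip : ∀ {A B : Set} {P : A → Set} {Q : B → Set} {xs ys} → All P xs → All Q ys →
    All (λ p → P (proj₁ p) × Q (proj₂ p)) (zip xs ys)
  All-zip [] _ = []
  All-zip (_ ∷ _) [] = []
  All-zip (p ∷ ps) (q ∷ qs) = (p , q) ∷ All-zip ps qs

sumOver-↭ : ∀ (g : A → ℚ) {xs ys} → xs ↭ ys → sumOver g xs ≡ sumOver g ys
sumOver-↭ g Perm.refl = refl
sumOver-↭ g (Perm.prep x p) = cong (g x +_) (sumOver-↭ g p)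
sumOver-↭ g (Perm.swap {ys = ys} x y p) = trans (cong (λ z → g x + (g y + z)) (sumOver-↭ g p))
  (solve 3 (λ a b c → a :+ (b :+ c) := b :+ (a :+ c)) refl (g x) (g y) (sumOver g ys))
sumOver-↭ g (Perm.trans p q) = trans (sumOver-↭ g p) (sumOver-↭ g q)

-- Common denominators

fromℕ≡ι : ∀ n → fromℕ n ≡ ι (ℤ.+ n)
fromℕ≡ι zero = refl
fromℕ≡ι (suc n) = trans (cong (1ℚ +_) (fromℕ≡ι n)) (sym (ι-+ (ℤ.+ 1) (ℤ.+ n)))

fromℕ-+ : ∀ m n → fromℕ (m ℕ.+ n) ≡ fromℕ m + fromℕ n
fromℕ-+ zero n = sym (+-identityˡ _)
fromℕ-+ (suc m) n = trans (cong (1ℚ +_) (fromℕ-+ m n)) (sym (+-assoc 1ℚ (fromℕ m) (fromℕ n)))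

fromℕ-* : ∀ m n → fromℕ (m ℕ.* n) ≡ fromℕ m * fromℕ n
fromℕ-* zero n = sym (*-zeroˡ (fromℕ n))
fromℕ-* (suc m) n = trans (fromℕ-+ n (m ℕ.* n)) (trans (cong (fromℕ n +_) (fromℕ-* m n))
  (solve 2 (λ a b → b :+ a :* b := (con 1ℚ :+ a) :* b) refl (fromℕ m) (fromℕ n)))

0≤fromℕ : ∀ n → 0ℚ ≤ fromℕ n
0≤fromℕ zero = ≤-refl
0≤fromℕ (suc n) = +-nonNeg 0≤1 (0≤fromℕ n)

fromℕ-suc≢0 : ∀ n → fromℕ (suc n) ≢ 0ℚ
fromℕ-suc≢0 n eq = 1≢0 (sum-zeroˡ 0≤1 (0≤fromℕ n) eq)

numerator-fromℕ : ∀ n → ℤ.∣ ℚ.numerator (fromℕ n) ∣ ≡ n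
numerator-fromℕ n = cong (λ q → ℤ.∣ ℚ.numerator q ∣) (trans (fromℕ≡ι n) (ι-mk (ℤ.+ n)))

fromℕ-injective : ∀ {m n} → fromℕ m ≡ fromℕ n → m ≡ n
fromℕ-injective {m} {n} eq = trans (sym (numerator-fromℕ m))
  (trans (cong (λ q → ℤ.∣ ℚ.numerator q ∣) eq) (numerator-fromℕ n))

fromℕ-cancel-≤ : ∀ {m n} → fromℕ m ≤ fromℕ n → m ℕ.≤ n
fromℕ-cancel-≤ {m} {n} le with ℕₚ.≤-total m n
... | inj₁ m≤n = m≤n
... | inj₂ n≤m = ℕₚ.≤-reflexive (fromℕ-injective (≤-antisym le
  (subst (λ k → fromℕ n ≤ fromℕ k) (ℕₚ.m+[n∸m]≡n n≤m)
    (subst₂ _≤_ (+-identityʳ (fromℕ n)) (sym (fromℕ-+ n (m ℕ.∸ n))) (+-monoʳ-≤ (fromℕ n) (0≤fromℕ (m ℕ.∸ n)))))))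

int-nonNeg : ∀ {q} → IsInt q → 0ℚ ≤ q → ∃ λ n → q ≡ fromℕ n
int-nonNeg (ℤ.+ n , refl) _ = n , sym (fromℕ≡ι n)
int-nonNeg (ℤ.-[1+ n ] , refl) 0≤q = ⊥-elim (fromℕ-suc≢0 n (≤-antisym below-0 (0≤fromℕ (suc n))))
  where
  cancels : ι ℤ.-[1+ n ] + fromℕ (suc n) ≡ 0ℚ
  cancels = trans (cong (ι ℤ.-[1+ n ] +_) (fromℕ≡ι (suc n))) (trans (sym (ι-+ ℤ.-[1+ n ] (ℤ.+ suc n)))
    (cong ι (ℤₚ.+-inverseˡ (ℤ.+ suc n))))
  below-0 : fromℕ (suc n) ≤ 0ℚ
  below-0 = subst₂ _≤_ (+-identityˡ (fromℕ (suc n))) cancels (+-monoˡ-≤ (fromℕ (suc n)) 0≤q)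

Clears : ℕ → ℚ → Set
Clears N q = ∃ λ k → fromℕ N * q ≡ fromℕ k

clears-self : ∀ {q} → 0ℚ ≤ q → Clears (suc (ℚ.denominator-1 q)) q
clears-self {mkℚ (ℤ.+ n) d c} _ = n , trans (cong (_* mkℚ (ℤ.+ n) d c) (trans (fromℕ≡ι (suc d)) (ι-mk (ℤ.+ suc d))))
  (trans (toℚᵘ-injective (ℚᵘ.≃-trans (toℚᵘ-homo-* (mkℚ (ℤ.+ suc d) 0 (Coprime.sym (Coprime.1-coprimeTo (suc d)))) (mkℚ (ℤ.+ n) d c))
    (ℚᵘ.*≡* cross))) (sym (trans (fromℕ≡ι n) (ι-mk (ℤ.+ n)))))
  where
  cross : (ℤ.+ suc d ℤ.* ℤ.+ n) ℤ.* ℤ.+ 1 ≡ ℤ.+ n ℤ.* (ℤ.+ 1 ℤ.* ℤ.+ suc d)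
  cross = trans (ℤₚ.*-identityʳ _) (trans (ℤₚ.*-comm (ℤ.+ suc d) (ℤ.+ n)) (cong (ℤ.+ n ℤ.*_) (sym (ℤₚ.*-identityˡ (ℤ.+ suc d)))))
clears-self {mkℚ ℤ.-[1+ n ] d c} (*≤* ())

clears-*ˡ : ∀ N D {q} → Clears N q → Clears (D ℕ.* N) q
clears-*ˡ N D {q} (k , eq) = D ℕ.* k , trans (cong (_* q) (fromℕ-* D N))
  (trans (*-assoc (fromℕ D) (fromℕ N) q) (trans (cong (fromℕ D *_) eq) (sym (fromℕ-* D k))))

common-denominator : ∀ {qs} → All (0ℚ ≤_) qs → ∃ λ N → All (Clears (suc N)) qs
common-denominator [] = 0 , []
common-denominator {q ∷ qs} (p ∷ ps) with common-denominator ps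
-- The successor of this number is the product of `suc N` and the denominator of `q`.
... | N , cs = N ℕ.+ ℚ.denominator-1 q ℕ.* suc N ,
  subst (λ M → Clears M q) (ℕₚ.*-comm (suc N) (suc (ℚ.denominator-1 q))) (clears-*ˡ (suc (ℚ.denominator-1 q)) (suc N) (clears-self p)) ∷
  All.map (clears-*ˡ (suc N) (suc (ℚ.denominator-1 q))) cs

sumOver-replicate : ∀ (f : A → ℚ) k a → sumOver f (replicate k a) ≡ fromℕ k * f a
sumOver-replicate f zero a = sym (*-zeroˡ (f a))
sumOver-replicate f (suc k) a = trans (cong (f a +_) (sumOver-replicate f k a))
  (solve 2 (λ k x → x :+ k :* x := (con 1ℚ :+ k) :* x) refl (fromℕ k) (f a))

-- An element of weight `c` is repeated `N * c` times.
expand : ∀ {R : A → Set} N M → Supp R M → All (Clears N) (map proj₁ M) →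
  ∃ λ xs → All R xs × (∀ f → sumOver f xs ≡ fromℕ N * ∫ f M)
expand N [] _ _ = [] , [] , λ _ → sym (*-zeroʳ (fromℕ N))
expand N ((c , a) ∷ M) (r ∷ rs) ((k , eq) ∷ cs) with expand N M rs cs
... | xs , all , sums = replicate k a ++ xs , Allₚ.++⁺ (Allₚ.replicate⁺ k r) all , λ f →
  trans (sumOver-++ f (replicate k a) xs) (trans (cong₂ _+_ (trans (sumOver-replicate f k a) (cong (_* f a) (sym eq))) (sums f))
    (solve 4 (λ N c x y → N :* c :* x :+ N :* y := N :* (c :* x :+ y)) refl (fromℕ N) c (f a) (∫ f M)))

-- Convex and conical combinations

dot-lin : ∀ (c : Point n) M → dot c (lin M) ≡ ∫ (dot c) M
dot-lin {n} c [] = dot-origin c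
  where
  dot-origin : ∀ {n} (c : Point n) → dot c (origin n) ≡ 0ℚ
  dot-origin Vec.[] = refl
  dot-origin (x Vec.∷ c) = trans (cong₂ _+_ (*-zeroʳ x) (dot-origin c)) (+-identityˡ 0ℚ)
dot-lin c ((k , p) ∷ M) = trans (dot-⊕ c k p (lin M)) (cong (k * dot c p +_) (dot-lin c M))
  where
  dot-⊕ : ∀ {n} (c : Point n) k p q → dot c ((k · p) ⊕ q) ≡ k * dot c p + dot c q
  dot-⊕ Vec.[] k Vec.[] Vec.[] = sym (trans (+-identityʳ (k * 0ℚ)) (*-zeroʳ k))
  dot-⊕ (x Vec.∷ c) k (y Vec.∷ p) (z Vec.∷ q) = trans (cong (x * (k * y + z) +_) (dot-⊕ c k p q))
    (solve 6 (λ x k y z u v → x :* (k :* y :+ z) :+ (k :* u :+ v) := k :* (x :* y :+ u) :+ (x :* z :+ v)) refl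
      x k y z (dot c p) (dot c q))

affine-lin : ∀ (c : Point n) c₀ M → wsum M ≡ 1ℚ → affine c c₀ (lin M) ≡ ∫ (affine c c₀) M
affine-lin c c₀ M w = begin
  dot c (lin M) + c₀ ≡⟨ cong₂ _+_ (dot-lin c M) (trans (sym (*-identityʳ c₀)) (cong (c₀ *_) (trans (sym w) (wsum≡∫ M)))) ⟩
  ∫ (dot c) M + c₀ * ∫ (const 1ℚ) M ≡⟨ cong (∫ (dot c) M +_) (sym (∫-* c₀ (const 1ℚ) M)) ⟩
  ∫ (dot c) M + ∫ (λ _ → c₀ * 1ℚ) M ≡⟨ sym (∫-+ (dot c) (λ _ → c₀ * 1ℚ) M) ⟩
  ∫ (λ a → dot c a + c₀ * 1ℚ) M ≡⟨ ∫-cong M (All.universal (λ w → cong (dot c (proj₂ w) +_) (*-identityʳ c₀)) M) ⟩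
  ∫ (affine c c₀) M ∎

lin-++ : ∀ (M N : Measure (Point n)) → lin (M ++ N) ≡ lin M ⊕ lin N
lin-++ M N = vec-ext λ i → trans (lookup-lin (M ++ N) i) (trans (∫-++ _ M N)
  (trans (sym (cong₂ _+_ (lookup-lin M i) (lookup-lin N i))) (sym (Vecₚ.lookup-zipWith _+_ i (lin M) (lin N)))))

-- The mass is a parameter because the second component of a point of the semidirect product over
-- `a` is a combination of total weight `φ a`.
record Cone {n} (R : Point n → Set) (m : ℚ) (x : Point n) : Set where
  constructor cone
  field
    measure : Measure (Point n)
    nonNeg : NonNeg measure
    supp : Supp R measure
    mass : wsum measure ≡ m
    sum : lin measure ≡ x

conv⇒cone : ∀ {R : Point n → Set} {x} → Conv R x → Cone R 1ℚ x
conv⇒cone (M , p , w , l) = cone M (proj₁ (All.unzip p)) (proj₂ (All.unzip p)) w l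

cone⇒conv : ∀ {R : Point n → Set} {x} → Cone R 1ℚ x → Conv R x
cone⇒conv (cone M nn s w l) = M , All.zip (nn , s) , w , l

cone-scale : ∀ {R : Point n → Set} {m x k} → 0ℚ ≤ k → Cone R m x → Cone R (k * m) (k · x)
cone-scale {k = k} 0≤k (cone M nn s w l) = cone (scale k M) (scale-nonNeg 0≤k nn) (scale-supp {k = k} s)
  (trans (wsum-scale k M) (cong (k *_) w)) (trans (lin-scale k M) (cong (k ·_) l))

cone-⊕ : ∀ {R : Point n → Set} {m m′ x x′} → Cone R m x → Cone R m′ x′ → Cone R (m + m′) (x ⊕ x′)
cone-⊕ (cone M nM sM wM lM) (cone N nN sN wN lN) = cone (M ++ N) (Allₚ.++⁺ nM nN) (Allₚ.++⁺ sM sN)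
  (trans (wsum≡∫ (M ++ N)) (trans (∫-++ _ M N) (cong₂ _+_ (trans (sym (wsum≡∫ M)) wM) (trans (sym (wsum≡∫ N)) wN))))
  (trans (lin-++ M N) (cong₂ _⊕_ lM lN))

flatten : ∀ {R : Point n → Set} {M} → NonNeg M → Supp (Conv R) M → Cone R (wsum M) (lin M)
flatten [] [] = cone [] [] [] refl refl
flatten {M = (c , p) ∷ M} (0≤c ∷ nn) (q ∷ qs) with cone-⊕ (cone-scale 0≤c (conv⇒cone q)) (flatten nn qs)
... | cone N nN sN wN lN = cone N nN sN (trans wN (cong (_+ wsum M) (*-identityʳ c))) lN

zero-· : ∀ (p : Point n) → 0ℚ · p ≡ origin n
zero-· Vec.[] = refl
zero-· (x Vec.∷ p) = cong₂ Vec._∷_ (*-zeroˡ x) (zero-· p)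

·-assoc : ∀ a b (p : Point n) → a · (b · p) ≡ (a * b) · p
·-assoc a b p = trans (sym (Vecₚ.map-∘ (a *_) (b *_) p)) (Vecₚ.map-cong (λ x → sym (*-assoc a b x)) p)

one-· : ∀ (p : Point n) → 1ℚ · p ≡ p
one-· p = trans (Vecₚ.map-cong *-identityˡ p) (Vecₚ.map-id p)

-- The point p₀ only serves when m = 0.
radial : ∀ {R : Point n → Set} {m x p₀} → Conv R p₀ → Cone R m x → ∃ λ p → Conv R p × x ≡ m · p
radial {m = m} {x} {p₀} r (cone M nn s w l) with m ℚₚ.≟ 0ℚ
... | yes m≡0 = p₀ , r , trans (sym l) (trans (lin-cong M≈[]) (sym (trans (cong (_· p₀) m≡0) (zero-· p₀))))
  where
  M≈[] : M ≈ []
  M≈[] = equal (null nn (trans (sym (wsum≡∫ M)) (trans w m≡0)))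
... | no m≢0 with inverse (subst (0ℚ ≤_) (trans (sym (wsum≡∫ M)) w) (∫-nonNeg nn (All.universal (λ _ → 0≤1) M))) m≢0
...   | k , 0≤k , m*k≡1 = k · x , cone⇒conv (subst (λ m → Cone _ m (k · x)) (trans (*-comm k m) m*k≡1)
          (cone-scale 0≤k (cone M nn s w l))) ,
        sym (trans (·-assoc m k x) (trans (cong (_· x) m*k≡1) (one-· x)))

conv-nonempty : ∀ {σ : List (Point n)} {x} → conv σ x → ∃ (_∈ σ)
conv-nonempty {σ = v ∷ σ} _ = v , here refl
conv-nonempty {σ = []} ([] , _ , () , _)
conv-nonempty {σ = []} (_ ∷ _ , (_ , ()) ∷ _ , _)

vertex-conv : ∀ {R : Point n → Set} {p} → R p → Conv R p
vertex-conv {p = p} r = (1ℚ , p) ∷ [] , (0≤1 , r) ∷ [] , +-identityʳ 1ℚ ,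
  trans (Vecₚ.zipWith-identityʳ +-identityʳ (1ℚ · p)) (one-· p)

-- The combination is `m` times a point of the polytope; a cell containing that point is found, and
-- the result is scaled back. A vertex of the cell is returned as well, since a combination of mass
-- zero need not supply one.
cover-cone : ∀ {R : Point n → Set} {S V m x p₀} → IsTriangulation R S → (∀ {p} → conv V p → R p) → conv V p₀ →
  0ℚ ≤ m → Cone (_∈ V) m x → ∃ λ σ → σ ∈ S × ∃ (_∈ σ) × Cone (_∈ σ) m x
cover-cone {m = m} (_ , _ , cover , _) inside p₀∈ 0≤m x∈ with radial p₀∈ x∈
... | p , p∈ , x≡ with cover p (inside p∈)
...   | σ , σ∈ , p∈σ = σ , σ∈ , conv-nonempty p∈σ ,
        subst₂ (Cone _) (*-identityʳ m) (sym x≡) (cone-scale 0≤m (conv⇒cone p∈σ))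

zip-push : ∀ (g : A → B) ls as → zip ls (map g as) ≡ push g (zip ls as)
zip-push g [] as = refl
zip-push g (l ∷ ls) [] = refl
zip-push g (l ∷ ls) (a ∷ as) = cong (_ ∷_) (zip-push g ls as)

zip-tokens : ∀ (ls : List ℚ) (as : List A) → length ls ≡ length as → map proj₂ (zip ls as) ≡ as
zip-tokens [] [] _ = refl
zip-tokens (l ∷ ls) (a ∷ as) len = cong (a ∷_) (zip-tokens ls as (cong ℕ.pred len))

zip-nonNeg : ∀ {ls} (as : List A) → All (0ℚ ≤_) ls → NonNeg (zip ls as)
zip-nonNeg as [] = []
zip-nonNeg [] (_ ∷ _) = []
zip-nonNeg (a ∷ as) (p ∷ ps) = p ∷ zip-nonNeg as ps

sumOver-1 : ∀ (s : List A) → sumOver (const 1ℚ) s ≡ fromℕ (length s)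
sumOver-1 [] = refl
sumOver-1 (_ ∷ s) = cong (1ℚ +_) (sumOver-1 s)

weighted : ℚ → List A → Measure A
weighted k = map (k ,_)

∫-weighted : ∀ (f : A → ℚ) k s → ∫ f (weighted k s) ≡ k * sumOver f s
∫-weighted f k [] = sym (*-zeroʳ k)
∫-weighted f k (x ∷ s) = trans (cong (k * f x +_) (∫-weighted f k s)) (sym (*-distribˡ-+ k (f x) (sumOver f s)))

ones : List A → Measure A
ones = weighted 1ℚ

∫-ones : ∀ (f : A → ℚ) s → ∫ f (ones s) ≡ sumOver f s
∫-ones f s = trans (∫-weighted f 1ℚ s) (*-identityˡ _)

ints : ∀ {ls} → All IsInt ls → ∃ λ ks → map ι ks ≡ ls
ints [] = [] , refl
ints ((k , refl) ∷ is) with ints is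
... | ks , refl = k ∷ ks , refl

origin-++ : ∀ m n → origin (m ℕ.+ n) ≡ origin m Vec.++ origin n
origin-++ zero n = refl
origin-++ (suc m) n = cong (0ℚ Vec.∷_) (origin-++ m n)

take-++ : ∀ {m n} (u : Vec A m) (v : Vec A n) → Vec.take m (u Vec.++ v) ≡ u
take-++ Vec.[] v = refl
take-++ (x Vec.∷ u) v = cong (x Vec.∷_) (take-++ u v)

combine-++ : ∀ {m n} k (p q : Point m) (r s : Point n) →
  (k · (p Vec.++ r)) ⊕ (q Vec.++ s) ≡ ((k · p) ⊕ q) Vec.++ ((k · r) ⊕ s)
combine-++ k p q r s = trans (cong (_⊕ (q Vec.++ s)) (Vecₚ.map-++ (k *_) p r)) (Vecₚ.zipWith-++ _+_ (k · p) (k · r) q s)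

-- The triangulation

module Construction
  (d e : ℕ) (VQ : List (Point d)) (VP : List (Point e))
  (S : List (List (Point d))) (unimodularS : IsUnimodularTriangulation (conv VQ) S)
  (T : List (List (Point e))) (unimodularT : IsUnimodularTriangulation (conv VP) T)
  (c : Point d) (c₀ : ℚ)
  (φ-int : ∀ a → IsLattice a → IsInt (affine c c₀ a))
  (φ-nonNeg : ∀ a → conv VQ a → 0ℚ ≤ affine c c₀ a)
  where

  φ : Point d → ℚ
  φ = affine c c₀

  triS : IsTriangulation (conv VQ) S
  triS = proj₁ unimodularS

  triT : IsTriangulation (conv VP) T
  triT = proj₁ unimodularT

  insideS : ∀ {σ x} → σ ∈ S → conv σ x → conv VQ x
  insideS σ∈S = All.lookup (proj₁ (proj₂ triS)) σ∈S _

  insideT : ∀ {τ x} → τ ∈ T → conv τ x → conv VP x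
  insideT τ∈T = All.lookup (proj₁ (proj₂ triT)) τ∈T _

  uniS : ∀ {σ} → σ ∈ S → Unimodular σ
  uniS = All.lookup (proj₂ unimodularS)

  uniT : ∀ {τ} → τ ∈ T → Unimodular τ
  uniT = All.lookup (proj₂ unimodularT)

  -- Meaningful on the vertices of cells of `S`, where `φ` is a nonnegative integer and `height`
  -- recovers it.
  ht : Point d → ℕ
  ht v = ℤ.∣ ℚ.numerator (φ v) ∣

  height : ∀ {σ v} → σ ∈ S → v ∈ σ → φ v ≡ fromℕ (ht v)
  height {v = v} σ∈S v∈σ with int-nonNeg (φ-int v (All.lookup (proj₁ (uniS σ∈S)) v∈σ)) (φ-nonNeg v (insideS σ∈S (vertex-conv v∈σ)))
  ... | n , φv≡n = trans φv≡n (cong fromℕ (sym (trans (cong (λ q → ℤ.∣ ℚ.numerator q ∣) φv≡n) (numerator-fromℕ n))))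

  -- Putting φ v in front makes the order on vertices refine the order by height.
  ordV : IsDecTotalOrder _≡_ (λ u v → Lex.Lex-≤ _≡_ _≤_ (φ u Vec.∷ u) (φ v Vec.∷ v))
  ordV = pull-order (λ v → φ v Vec.∷ v) Vecₚ.∷-injectiveʳ (lex-order (suc d))

  ordW : IsDecTotalOrder _≡_ (Lex.Lex-≤ _≡_ _≤_ {e} {e})
  ordW = lex-order e

  open Words ordW
  open Tokens ordV ordW ht
  open Filling ordW

  -- Tokens as points of the product

  Over : List (Point d) → List (Point e) → Token → Set
  Over σ τ (v , s) = v ∈ σ × All (_∈ τ) s

  pt : Token → Point (d ℕ.+ e)
  pt (v , s) = v Vec.++ lin (ones s)

  -- A measure on tokens is viewed as a pair of measures, on vertices and on letters.
  onVertices : Measure Token → Measure (Point d)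
  onVertices = push proj₁

  onLetters : Measure Token → Measure (Point e)
  onLetters [] = []
  onLetters ((k , (v , s)) ∷ M) = scale k (ones s) ++ onLetters M

  ∫-letters : ∀ g M → ∫ g (onLetters M) ≡ ∫ (sumOver g ∘ proj₂) M
  ∫-letters g [] = refl
  ∫-letters g ((k , (v , s)) ∷ M) = trans (∫-++ g (scale k (ones s)) (onLetters M))
    (cong₂ _+_ (trans (∫-scale g k (ones s)) (cong (k *_) (∫-ones g s))) (∫-letters g M))

  -- Reduces functionals on tokens to integrals over vertices and over letters, to which the
  -- properties of `σ` and `τ` apply separately.
  ∫-value : ∀ h M → ∫ (value h) M ≡ ∫ (onV h) (onVertices M) + ∫ (onW h) (onLetters M)
  ∫-value h M = trans (∫-+ (onV h ∘ proj₁) (sumOver (onW h) ∘ proj₂) M)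
    (sym (cong₂ _+_ (∫-push (onV h) proj₁ M) (∫-letters (onW h) M)))

  lin-pt : ∀ M → lin (push pt M) ≡ lin (onVertices M) Vec.++ lin (onLetters M)
  lin-pt [] = origin-++ d e
  lin-pt ((k , (v , s)) ∷ M) = begin
    (k · (v Vec.++ lin (ones s))) ⊕ lin (push pt M) ≡⟨ cong ((k · (v Vec.++ lin (ones s))) ⊕_) (lin-pt M) ⟩
    (k · (v Vec.++ lin (ones s))) ⊕ (lin (onVertices M) Vec.++ lin (onLetters M)) ≡⟨ combine-++ k v _ _ _ ⟩
    ((k · v) ⊕ lin (onVertices M)) Vec.++ ((k · lin (ones s)) ⊕ lin (onLetters M))
      ≡⟨ cong (((k · v) ⊕ lin (onVertices M)) Vec.++_) (sym (trans (lin-++ (scale k (ones s)) (onLetters M))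
        (cong (_⊕ lin (onLetters M)) (lin-scale k (ones s))))) ⟩
    ((k · v) ⊕ lin (onVertices M)) Vec.++ lin (scale k (ones s) ++ onLetters M) ∎

  wsum-pt : ∀ M → wsum (push pt M) ≡ wsum (onVertices M)
  wsum-pt M = trans (wsum≡∫ (push pt M)) (trans (∫-push _ pt M) (sym (trans (wsum≡∫ (onVertices M)) (∫-push _ proj₁ M))))

  -- A token over `v` has `ht v` letters, so the vertex measure fixes the mass of the letter
  -- measure. Arguments about `τ` need this mass in addition to the second component of the point.
  wsum-letters : ∀ {M} → Supp Good M → wsum (onLetters M) ≡ ∫ (fromℕ ∘ ht) (onVertices M)
  wsum-letters {M} good = trans (wsum≡∫ (onLetters M)) (trans (∫-letters (const 1ℚ) M)
    (trans (∫-cong M (All.map (λ { {_ , (_ , s)} (len , _) → trans (sumOver-1 s) (cong fromℕ len) }) good))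
      (sym (∫-push (fromℕ ∘ ht) proj₁ M))))

  vertices-supp : ∀ {σ τ M} → Supp (Over σ τ) M → Supp (_∈ σ) (onVertices M)
  vertices-supp over = push-supp (All.map proj₁ over)

  letters-supp : ∀ {σ τ M} → Supp (Over σ τ) M → Supp (_∈ τ) (onLetters M)
  letters-supp [] = []
  letters-supp {M = (k , _) ∷ _} ((_ , s∈) ∷ over) = Allₚ.++⁺ (scale-supp {k = k} (Allₚ.map⁺ s∈)) (letters-supp over)

  letters-nonNeg : ∀ {M} → NonNeg M → NonNeg (onLetters M)
  letters-nonNeg [] = []
  letters-nonNeg {(_ , (_ , s)) ∷ _} (0≤k ∷ nn) =
    Allₚ.++⁺ (scale-nonNeg 0≤k (Allₚ.map⁺ (All.universal (λ _ → 0≤1) s))) (letters-nonNeg nn)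

  -- Cells as unimodular simplices

  record IsCell (ts : List Token) : Set where
    field
      {σ} : List (Point d)
      {τ} : List (Point e)
      {w₀} : Point e
      σ∈S : σ ∈ S
      τ∈T : τ ∈ T
      -- This keeps `τ` nonempty even when all words are empty, as over vertices of height 0.
      w₀∈τ : w₀ ∈ τ
      over : All (Over σ τ) ts
      chain : Chain ts

  -- The vertex part of a vanishing combination is zero because `σ` is affinely independent. Its
  -- letter part then has mass zero and is zero because `τ` is, so all functionals vanish and
  -- `coefficients` applies.
  cell-affIndep : ∀ {ts} → IsCell ts → AffIndep (map pt ts)
  cell-affIndep {ts} cell ls len q l =
    coefficients (_≡ 0ℚ) (λ { refl refl → refl }) (λ { {z = z} refl _ → *-zeroˡ z }) chain len′
      λ h → trans (∫-value h M) (trans (cong₂ _+_ (vertices-vanish (onV h)) (letters-vanish (onW h))) (+-identityˡ 0ℚ))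
    where
    open IsCell cell
    len′ : length ls ≡ length ts
    len′ = trans len (length-map pt ts)
    M = zip ls ts
    lin≡ : lin (onVertices M) Vec.++ lin (onLetters M) ≡ origin d Vec.++ origin e
    lin≡ = trans (sym (lin-pt M)) (trans (cong lin (sym (zip-push pt ls ts))) (trans l (origin-++ d e)))
    supp : Supp (Over σ τ) M
    supp = zip-All ls over
    vertices-vanish : ∀ f → ∫ f (onVertices M) ≡ 0ℚ
    vertices-vanish = vanishing (proj₁ (proj₂ (uniS σ∈S))) (vertices-supp supp)
      (trans (sym (wsum-pt M)) (trans (cong wsum (sym (zip-push pt ls ts))) (trans (sym (qsum≡wsum ls (map pt ts) len)) q)))
      (Vecₚ.++-injectiveˡ _ _ lin≡)
    letters-vanish : ∀ f → ∫ f (onLetters M) ≡ 0ℚ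
    letters-vanish = vanishing (proj₁ (proj₂ (uniT τ∈T))) (letters-supp supp)
      (trans (wsum-letters (zip-All ls (proj₁ chain))) (vertices-vanish (fromℕ ∘ ht)))
      (Vecₚ.++-injectiveʳ (lin (onVertices M)) _ lin≡)

  lattice-ones : ∀ {s : List (Point e)} → All IsLattice s → IsLattice (lin (ones s))
  lattice-ones [] = VAll-origin e
    where
    VAll-origin : ∀ n → IsLattice (origin n)
    VAll-origin zero = VAll.[]
    VAll-origin (suc n) = int0 VAll.∷ VAll-origin n
  lattice-ones (i ∷ is) = lattice-lin int1 i (lattice-ones is)

  -- The argument for affine independence is repeated with integrality in place of vanishing. The
  -- mass of the letters is an integer but need not be 1, hence `integral` instead of `integral₁`.
  cell-unimodular : ∀ {ts} → IsCell ts → Unimodular (map pt ts)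
  cell-unimodular {ts} cell = Allₚ.map⁺ (All.map lattice-pt over) , cell-affIndep cell , integer-coordinates
    where
    open IsCell cell
    lattice-pt : ∀ {t} → Over σ τ t → IsLattice (pt t)
    lattice-pt (v∈σ , s∈τ) = VAllₚ.++⁺ (All.lookup (proj₁ (uniS σ∈S)) v∈σ) (lattice-ones (All.map (All.lookup (proj₁ (uniT τ∈T))) s∈τ))
    integer-coordinates : ∀ x → IsLattice x → InAff (map pt ts) x → InAffℤ (map pt ts) x
    integer-coordinates x lat (ls , len , q , l) = finish (ints (coefficients IsInt int-- int-* chain len′ int-values))
      where
      len′ : length ls ≡ length ts
      len′ = trans len (length-map pt ts)
      M = zip ls ts
      x≡ : lin (onVertices M) Vec.++ lin (onLetters M) ≡ x
      x≡ = trans (sym (lin-pt M)) (trans (cong lin (sym (zip-push pt ls ts))) l)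
      lat′ : IsLattice (lin (onVertices M) Vec.++ lin (onLetters M))
      lat′ = subst IsLattice (sym x≡) lat
      supp : Supp (Over σ τ) M
      supp = zip-All ls over
      vertices-int : ∀ {f} → (∀ v → IsInt (f v)) → IsInt (∫ f (onVertices M))
      vertices-int = integral₁ (uniS σ∈S) (vertices-supp supp)
        (trans (sym (wsum-pt M)) (trans (cong wsum (sym (zip-push pt ls ts))) (trans (sym (qsum≡wsum ls (map pt ts) len)) q)))
        (proj₁ (VAllₚ.++⁻ (lin (onVertices M)) lat′))
      letters-int : ∀ {f} → (∀ v → IsInt (f v)) → IsInt (∫ f (onLetters M))
      letters-int = integral (uniT τ∈T) w₀∈τ (letters-supp supp)
        (subst IsInt (sym (wsum-letters (zip-All ls (proj₁ chain)))) (vertices-int (int-fromℕ ∘ ht)))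
        (proj₂ (VAllₚ.++⁻ (lin (onVertices M)) lat′))
      int-values : ∀ h → IsInt (∫ (value h) M)
      int-values h = subst IsInt (sym (∫-value h M)) (int-+ (vertices-int (onV-int h)) (letters-int (onW-int h)))
      finish : (∃ λ ks → map ι ks ≡ ls) → InAffℤ (map pt ts) x
      finish (ks , refl) = ks , trans (sym (length-map ι ks)) len , q , l

  -- Position of the cells: containment, projection and intersection

  record Lift (ts : List Token) (x : Point (d ℕ.+ e)) : Set where
    field
      M : Measure Token
      -- The weights are listed along the chain itself, zeros included, so that `M` inherits its
      -- order.
      tokens≡ : tokens M ≡ ts
      nonNeg : NonNeg M
      mass : wsum (push pt M) ≡ 1ℚ
      sum : lin (push pt M) ≡ x

  lift : ∀ {ts x} → conv (map pt ts) x → Lift ts x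
  lift {ts} (ws , p , w , l) with collect (proj₂ (All.unzip p))
  ... | ls , len , eq , nn = record
    { M = zip ls ts
    ; tokens≡ = zip-tokens ls ts (trans len (length-map pt ts))
    ; nonNeg = zip-nonNeg ts (nn (proj₁ (All.unzip p)))
    ; mass = trans (cong wsum (sym (zip-push pt ls ts))) (trans (wsum-cong eq) w)
    ; sum = trans (cong lin (sym (zip-push pt ls ts))) (trans (lin-cong eq) l)
    }

  Gen : Point (d ℕ.+ e) → Set
  Gen y = ∃ λ a → ∃ λ p → conv VQ a × conv VP p × y ≡ a Vec.++ (φ a · p)

  -- A token over `v` has `ht v` letters in `τ`, whose sum is therefore `φ v` times a point of `τ`.
  -- So each vertex of the cell is one of the generators.
  cell-inside : ∀ {ts} → IsCell ts → ∀ x → conv (map pt ts) x → Semidirect (conv VQ) φ (conv VP) x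
  cell-inside {ts} cell x (ws , p , w , l) = ws , All.map (λ { (0≤k , y∈) → 0≤k , All.lookup gens y∈ }) p , w , l
    where
    open IsCell cell
    gen : ∀ {t} → Good t × Over σ τ t → Gen (pt t)
    gen {v , s} ((len , _) , (v∈σ , s∈τ)) =
      v , proj₁ point , insideS σ∈S (vertex-conv v∈σ) , insideT τ∈T (proj₁ (proj₂ point)) , cong (v Vec.++_) (proj₂ (proj₂ point))
      where
      letters-cone : Cone (_∈ τ) (φ v) (lin (ones s))
      letters-cone = cone (ones s) (Allₚ.map⁺ (All.universal (λ _ → 0≤1) s)) (Allₚ.map⁺ s∈τ)
        (trans (wsum≡∫ (ones s)) (trans (∫-ones (const 1ℚ) s) (trans (sumOver-1 s)
          (trans (cong fromℕ len) (sym (height σ∈S v∈σ)))))) refl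
      point : ∃ λ q → conv τ q × lin (ones s) ≡ φ v · q
      point = radial (vertex-conv w₀∈τ) letters-cone
    gens : All Gen (map pt ts)
    gens = Allₚ.map⁺ (All.map gen (All.zip (proj₁ chain , over)))

  cell-over : ∀ {ts} → (cell : IsCell ts) → ∀ x → conv (map pt ts) x → conv (IsCell.σ cell) (π {d} {e} x)
  cell-over {ts} cell x x∈ = onVertices M ,
    All.zip (push-nonNeg nonNeg , vertices-supp supp) ,
    trans (sym (wsum-pt M)) mass ,
    sym (trans (cong (Vec.take d) (trans (sym sum) (lin-pt M))) (take-++ (lin (onVertices M)) _))
    where
    open IsCell cell
    open Lift (lift x∈)
    supp : Supp (Over σ τ) M
    supp = Allₚ.map⁻ (subst (All (Over σ τ)) (sym tokens≡) over)

  -- Two expressions of `x` have the same vertex measure because `S` is a triangulation. Hence their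
  -- letter masses agree, and then their letter measures because `T` is one. All functionals now
  -- agree, and `common` finds an expression on shared tokens.
  cells-meet : ∀ {ts us} → IsCell ts → IsCell us → ∀ x → conv (map pt ts) x → conv (map pt us) x →
    Conv (λ y → y ∈ map pt ts × y ∈ map pt us) x
  cells-meet {ts} {us} cell₁ cell₂ x x∈₁ x∈₂ =
    push pt K , All.zip (push-nonNeg nK , push-supp (All.map (λ {w} → in-both {proj₂ w}) sK)) ,
    trans (wsum-pt K) (trans (wsum-cong (push-≈ proj₁)) (trans (sym (wsum-pt L₁.M)) L₁.mass)) ,
    trans (lin-cong (push-≈ pt)) L₁.sum
    where
    module C₁ = IsCell cell₁
    module C₂ = IsCell cell₂
    module L₁ = Lift (lift x∈₁)
    module L₂ = Lift (lift x∈₂)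
    over₁ : Supp (Over C₁.σ C₁.τ) L₁.M
    over₁ = Allₚ.map⁻ (subst (All (Over C₁.σ C₁.τ)) (sym L₁.tokens≡) C₁.over)
    over₂ : Supp (Over C₂.σ C₂.τ) L₂.M
    over₂ = Allₚ.map⁻ (subst (All (Over C₂.σ C₂.τ)) (sym L₂.tokens≡) C₂.over)
    chain₁ : Chain (tokens L₁.M)
    chain₁ = subst Chain (sym L₁.tokens≡) C₁.chain
    chain₂ : Chain (tokens L₂.M)
    chain₂ = subst Chain (sym L₂.tokens≡) C₂.chain
    lin≡ : lin (onVertices L₁.M) Vec.++ lin (onLetters L₁.M) ≡ lin (onVertices L₂.M) Vec.++ lin (onLetters L₂.M)
    lin≡ = trans (sym (lin-pt L₁.M)) (trans L₁.sum (trans (sym L₂.sum) (lin-pt L₂.M)))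
    vertices≈ : onVertices L₁.M ≈ onVertices L₂.M
    vertices≈ = cell-independent triS C₁.σ∈S C₂.σ∈S (push-nonNeg L₁.nonNeg) (vertices-supp over₁)
      (push-nonNeg L₂.nonNeg) (vertices-supp {M = L₂.M} over₂)
      (trans (sym (wsum-pt L₁.M)) (trans L₁.mass (trans (sym L₂.mass) (wsum-pt L₂.M)))) (Vecₚ.++-injectiveˡ _ _ lin≡)
    letters≈ : onLetters L₁.M ≈ onLetters L₂.M
    letters≈ = cell-independent triT C₁.τ∈T C₂.τ∈T (letters-nonNeg L₁.nonNeg) (letters-supp over₁)
      (letters-nonNeg L₂.nonNeg) (letters-supp over₂)
      (trans (wsum-letters (Allₚ.map⁻ (proj₁ chain₁))) (trans (at vertices≈ (fromℕ ∘ ht)) (sym (wsum-letters (Allₚ.map⁻ (proj₁ chain₂))))))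
      (Vecₚ.++-injectiveʳ (lin (onVertices L₁.M)) _ lin≡)
    result : Common L₁.M L₂.M
    result = common _ L₁.M L₂.M ℕₚ.≤-refl chain₁ chain₂ L₁.nonNeg L₂.nonNeg
      λ h → trans (∫-value h L₁.M) (trans (cong₂ _+_ (at vertices≈ (onV h)) (at letters≈ (onW h))) (sym (∫-value h L₂.M)))
    K = proj₁ result
    nK = proj₁ (proj₂ (proj₂ result))
    sK = proj₂ (proj₂ (proj₂ result))
    push-≈ : ∀ {B : Set} (g : Token → B) → push g K ≈ push g L₁.M
    push-≈ g = equal λ f → trans (∫-push f g K) (trans (at (proj₁ (proj₂ result)) (f ∘ g)) (sym (∫-push f g L₁.M)))
    in-both : ∀ {t} → t ∈ tokens L₁.M × t ∈ tokens L₂.M → pt t ∈ map pt ts × pt t ∈ map pt us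
    in-both (t∈₁ , t∈₂) = ∈-map⁺ pt (subst (_ ∈_) L₁.tokens≡ t∈₁) , ∈-map⁺ pt (subst (_ ∈_) L₂.tokens≡ t∈₂)

  -- Covering the product by cells

  _≤ᵛ_ : Rel (Point d) 0ℓ
  u ≤ᵛ v = Lex.Lex-≤ _≡_ _≤_ (φ u Vec.∷ u) (φ v Vec.∷ v)

  -- Tokens may still repeat here; `chain-cover` removes the repetitions.
  record Staircase (σ : List (Point d)) (τ : List (Point e)) (vs : List (Point d)) (ws : List (Point e)) : Set where
    field
      ts : List Token
      good : All Good ts
      over : All (Over σ τ) ts
      nested : AllPairs _⊴_ ts
      vertex-sums : ∀ f → sumOver (f ∘ proj₁) ts ≡ sumOver f vs
      letter-sums : ∀ g → sumOver (sumOver g ∘ proj₂) ts ≡ sumOver g ws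

  heights-decrease : ∀ {σ vs} → σ ∈ S → All (_∈ σ) vs → AllPairs (λ u v → v ≤ᵛ u) vs → Decreasing (map ht vs)
  heights-decrease σ∈S [] [] = []
  heights-decrease σ∈S (u∈ ∷ vs∈) (u≥ ∷ desc) =
    Allₚ.map⁺ (All.map (λ { (v≤u , v∈) → fromℕ-cancel-≤ (subst₂ _≤_ (height σ∈S v∈) (height σ∈S u∈) (lex-head v≤u)) })
      (All.zip (u≥ , vs∈))) ∷ heights-decrease σ∈S vs∈ desc

  bounded : ∀ hs → ∃ λ n → All (ℕ._≤ n) hs
  bounded [] = 0 , []
  bounded (h ∷ hs) = h ℕ.⊔ proj₁ (bounded hs) , ℕₚ.m≤m⊔n h _ ∷ All.map (λ le → ℕₚ.≤-trans le (ℕₚ.m≤n⊔m h _)) (proj₂ (bounded hs))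

  -- Each vertex is paired with the row of the filling at the same position. Row lengths are the
  -- heights, and interlacing of rows becomes nesting of tokens.
  staircase : ∀ {σ τ vs ws} → σ ∈ S → All (_∈ σ) vs → All (_∈ τ) ws →
    AllPairs (λ u v → v ≤ᵛ u) vs → AllPairs (Lex.Lex-≤ _≡_ _≤_) ws → length ws ≡ total-length (map ht vs) → Staircase σ τ vs ws
  staircase {σ} {τ} {vs} {ws} σ∈S vs∈ ws∈ desc asc len = record
    { ts = zip vs F.rows
    ; good = goods vs F.rows F.lengths F.sorted
    ; over = overs vs∈ (All.map (All.map (All.lookup ws∈)) F.letters)
    ; nested = AllPairs.map (λ { (v≤u , i) → v≤u , i }) (AllPairs-zip desc F.interlaced)
    ; vertex-sums = λ f → sums₁ f vs F.rows F.lengths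
    ; letter-sums = λ g → trans (sums₂ (sumOver g) vs F.rows F.lengths) (F.sums g)
    }
    where
    module F = Filling.Filling (fill (proj₁ (bounded (map ht vs))) (map ht vs) ws (heights-decrease σ∈S vs∈ desc) (proj₂ (bounded (map ht vs))) asc len)
    goods : ∀ vs rows → map length rows ≡ map ht vs → All Sorted rows → All Good (zip vs rows)
    goods [] rows eq srt = []
    goods (v ∷ vs) (r ∷ rows) eq (s ∷ srt) = (Listₚ.∷-injectiveˡ eq , s) ∷ goods vs rows (Listₚ.∷-injectiveʳ eq) srt
    overs : ∀ {vs rows} → All (_∈ σ) vs → All (All (_∈ τ)) rows → All (Over σ τ) (zip vs rows)
    overs [] _ = []
    overs (_ ∷ _) [] = []
    overs (v∈ ∷ vs∈) (r∈ ∷ rs∈) = (v∈ , r∈) ∷ overs vs∈ rs∈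
    sums₁ : ∀ f vs rows → map length rows ≡ map ht vs → sumOver (f ∘ proj₁) (zip vs rows) ≡ sumOver f vs
    sums₁ f [] rows eq = refl
    sums₁ f (v ∷ vs) (r ∷ rows) eq = cong (f v +_) (sums₁ f vs rows (Listₚ.∷-injectiveʳ eq))
    sums₂ : ∀ (f : Row → ℚ) vs rows → map length rows ≡ map ht vs → sumOver (f ∘ proj₂) (zip vs rows) ≡ sumOver f rows
    sums₂ f [] [] eq = refl
    sums₂ f (v ∷ vs) (r ∷ rows) eq = cong (f r +_) (sums₂ f vs rows (Listₚ.∷-injectiveʳ eq))

  record Sorting {A : Set} (_⊑_ : Rel A 0ℓ) (xs : List A) : Set where
    field
      ys : List A
      ys↭xs : ys ↭ xs
      ordered : AllPairs _⊑_ ys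

  sorting : ∀ {A : Set} {_⊑_ : Rel A 0ℓ} → IsDecTotalOrder _≡_ _⊑_ → ∀ xs → Sorting _⊑_ xs
  sorting ord xs = record
    { ys = sort xs
    ; ys↭xs = sort-↭ xs
    ; ordered = Sorted⇒AllPairs (DecTotalOrder.totalOrder O) (sort-↗ xs)
    }
    where
    O : DecTotalOrder 0ℓ 0ℓ 0ℓ
    O = record { isDecTotalOrder = ord }
    open import Data.List.Sort O using (sort; sort-↭; sort-↗)

  fromℕ-total : ∀ {σ vs} → σ ∈ S → All (_∈ σ) vs → fromℕ (total-length (map ht vs)) ≡ sumOver φ vs
  fromℕ-total σ∈S [] = refl
  fromℕ-total {vs = v ∷ vs} σ∈S (v∈ ∷ vs∈) = trans (fromℕ-+ (ht v) (total-length (map ht vs)))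
    (cong₂ _+_ (sym (height σ∈S v∈)) (fromℕ-total σ∈S vs∈))

  -- `vs` and `ws` are `Λ` and `Μ` multiplied by one denominator `suc N`. Sharing it makes the
  -- number of letters comparable with the total height of the vertices.
  record CellCone (σ : List (Point d)) (τ : List (Point e)) (a : Point d) (q : Point e) : Set where
    field
      N : ℕ
      vs : List (Point d)
      ws : List (Point e)
      vs∈ : All (_∈ σ) vs
      ws∈ : All (_∈ τ) ws
      Λ : Measure (Point d)
      Μ : Measure (Point e)
      wΛ : wsum Λ ≡ 1ℚ
      lΛ : lin Λ ≡ a
      wΜ : wsum Μ ≡ φ a
      lΜ : lin Μ ≡ q
      vs-sums : ∀ f → sumOver f vs ≡ fromℕ (suc N) * ∫ f Λ
      ws-sums : ∀ f → sumOver f ws ≡ fromℕ (suc N) * ∫ f Μ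

  cell-cone : ∀ {σ τ a q} → Cone (_∈ σ) 1ℚ a → Cone (_∈ τ) (φ a) q → CellCone σ τ a q
  cell-cone (cone Λ nΛ sΛ wΛ lΛ) (cone Μ nΜ sΜ wΜ lΜ) = record
    { N = proj₁ den
    ; vs = proj₁ V ; ws = proj₁ W
    ; vs∈ = proj₁ (proj₂ V) ; ws∈ = proj₁ (proj₂ W)
    ; Λ = Λ ; Μ = Μ ; wΛ = wΛ ; lΛ = lΛ ; wΜ = wΜ ; lΜ = lΜ
    ; vs-sums = proj₂ (proj₂ V) ; ws-sums = proj₂ (proj₂ W)
    }
    where
    den = common-denominator (Allₚ.++⁺ (Allₚ.map⁺ nΛ) (Allₚ.map⁺ nΜ))
    V = expand (suc (proj₁ den)) Λ sΛ (Allₚ.++⁻ˡ (map proj₁ Λ) (proj₂ den))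
    W = expand (suc (proj₁ den)) Μ sΜ (Allₚ.++⁻ʳ (map proj₁ Λ) (proj₂ den))

  chain-cover : ∀ {σ τ w₀ a q} → σ ∈ S → τ ∈ T → w₀ ∈ τ → Cone (_∈ σ) 1ℚ a → Cone (_∈ τ) (φ a) q →
    ∃ λ ts → IsCell ts × conv (map pt ts) (a Vec.++ q)
  chain-cover {σ} {τ} {a = a} {q} σ∈S τ∈T w₀∈τ a∈ q∈ =
    ts′ , cell ,
    push pt M , All.zip (push-nonNeg weights-nonNeg , push-supp members) ,
    trans (wsum-pt M) (trans (wsum-cong vertices≈) wΛ) ,
    trans (lin-pt M) (cong₂ Vec._++_ (trans (lin-cong vertices≈) lΛ) (trans (lin-cong letters≈) lΜ))
    where
    open CellCone (cell-cone a∈ q∈)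
    module V = Sorting (sorting (Flip.isDecTotalOrder ordV) vs)
    module W = Sorting (sorting ordW ws)
    vs∈′ : All (_∈ σ) V.ys
    vs∈′ = All-resp-↭ (↭-sym V.ys↭xs) vs∈
    vs-sums′ : ∀ f → sumOver f V.ys ≡ fromℕ (suc N) * ∫ f Λ
    vs-sums′ f = trans (sumOver-↭ f V.ys↭xs) (vs-sums f)
    ws-sums′ : ∀ f → sumOver f W.ys ≡ fromℕ (suc N) * ∫ f Μ
    ws-sums′ f = trans (sumOver-↭ f W.ys↭xs) (ws-sums f)
    -- Both sides equal `φ a`, the right one because `φ` is affine and `Λ` has mass 1.
    ∫φ≡ : ∫ (const 1ℚ) Μ ≡ ∫ φ Λ
    ∫φ≡ = trans (sym (wsum≡∫ Μ)) (trans wΜ (trans (cong φ (sym lΛ)) (affine-lin c c₀ Λ wΛ)))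
    -- The letters fill the rows exactly: both counts are `suc N` times `φ a`.
    len : length W.ys ≡ total-length (map ht V.ys)
    len = fromℕ-injective (begin
      fromℕ (length W.ys) ≡⟨ sym (sumOver-1 W.ys) ⟩
      sumOver (const 1ℚ) W.ys ≡⟨ ws-sums′ (const 1ℚ) ⟩
      fromℕ (suc N) * ∫ (const 1ℚ) Μ ≡⟨ cong (fromℕ (suc N) *_) ∫φ≡ ⟩
      fromℕ (suc N) * ∫ φ Λ ≡⟨ sym (vs-sums′ φ) ⟩
      sumOver φ V.ys ≡⟨ sym (fromℕ-total σ∈S vs∈′) ⟩
      fromℕ (total-length (map ht V.ys)) ∎)
    open Staircase (staircase σ∈S vs∈′ (All-resp-↭ (↭-sym W.ys↭xs) ws∈) V.ordered W.ordered len)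
    inv = inverse (0≤fromℕ (suc N)) (fromℕ-suc≢0 N)
    k = proj₁ inv
    -- The weight `k` is the inverse of `suc N` and undoes the multiplication by the common
    -- denominator.
    M = weighted k ts
    cancel : ∀ x → k * (fromℕ (suc N) * x) ≡ x
    cancel x = trans (sym (*-assoc k (fromℕ (suc N)) x))
      (trans (cong (_* x) (trans (*-comm k (fromℕ (suc N))) (proj₂ (proj₂ inv)))) (*-identityˡ x))
    vertices≈ : onVertices M ≈ Λ
    vertices≈ = equal λ f → trans (∫-push f proj₁ M) (trans (∫-weighted (f ∘ proj₁) k ts)
      (trans (cong (k *_) (trans (vertex-sums f) (vs-sums′ f))) (cancel (∫ f Λ))))
    letters≈ : onLetters M ≈ Μ
    letters≈ = equal λ g → trans (∫-letters g M) (trans (∫-weighted (sumOver g ∘ proj₂) k ts)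
      (trans (cong (k *_) (trans (letter-sums g) (ws-sums′ g))) (cancel (∫ g Μ))))
    -- A cell lists each token once, while `M` keeps the repetitions; they still refer to vertices
    -- of the cell.
    ts′ = deduplicate _≟ᵗ_ ts
    weights-nonNeg : NonNeg M
    weights-nonNeg = Allₚ.map⁺ (All.universal (λ _ → proj₁ (proj₂ inv)) ts)
    members : Supp (λ t → pt t ∈ map pt ts′) M
    members = Allₚ.map⁺ (All.tabulate (λ t∈ → ∈-map⁺ pt (∈-deduplicate⁺ _≟ᵗ_ t∈)))
    from-ts : ∀ {P : Token → Set} → All P ts → All P ts′
    from-ts ps = All.tabulate (λ t∈ → All.lookup ps (∈-deduplicate⁻ _≟ᵗ_ ts t∈))
    cell : IsCell ts′
    cell = record
      { σ∈S = σ∈S ; τ∈T = τ∈T ; w₀∈τ = w₀∈τ ; over = from-ts over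
      ; chain = from-ts good , AllPairs.zip (AllPairs-deduplicate _≟ᵗ_ nested , deduplicate-! _≟ᵗ_ ts)
      }

  record Split (x : Point (d ℕ.+ e)) (m : ℚ) : Set where
    field
      α : Measure (Point d)
      β : Measure (Point e)
      nα : NonNeg α
      nβ : NonNeg β
      sα : Supp (conv VQ) α
      sβ : Supp (conv VP) β
      wα : wsum α ≡ m
      wβ : wsum β ≡ ∫ φ α
      l : lin α Vec.++ lin β ≡ x

  -- A generator of weight `k` contributes weight `k` at `a` and weight `k * φ a` at `p`. Nothing is
  -- divided by `φ a`, so generators over zeros of `φ` need no separate treatment.
  split : ∀ G → All (λ w → 0ℚ ≤ proj₁ w × Gen (proj₂ w)) G → Split (lin G) (wsum G)
  split [] [] = record { α = [] ; β = [] ; nα = [] ; nβ = [] ; sα = [] ; sβ = [] ; wα = refl ; wβ = refl ; l = sym (origin-++ d e) }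
  split ((k , y) ∷ G) ((0≤k , a , p , a∈ , p∈ , y≡) ∷ gs) = record
    { α = (k , a) ∷ α ; β = (k * φ a , p) ∷ β
    ; nα = 0≤k ∷ nα ; nβ = *-nonNeg 0≤k (φ-nonNeg a a∈) ∷ nβ
    ; sα = a∈ ∷ sα ; sβ = p∈ ∷ sβ
    ; wα = cong (k +_) wα ; wβ = cong (k * φ a +_) wβ
    ; l = sym (trans (cong₂ _⊕_ (cong (k ·_) y≡) (sym l)) (trans (combine-++ k a (lin α) (φ a · p) (lin β))
        (cong (λ z → ((k · a) ⊕ lin α) Vec.++ (z ⊕ lin β)) (·-assoc k (φ a) p))))
    }
    where open Split (split G gs)

  -- The first component lies in a cell of `S`. Since `φ` is affine, the second component has mass
  -- `φ` of the first, and `cover-cone` finds a cell of `T` for it.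
  covered : ∀ x → Semidirect (conv VQ) φ (conv VP) x → ∃ λ ts → IsCell ts × conv (map pt ts) x
  covered x (G , gens , w , l) =
    proj₁ result , proj₁ (proj₂ result) , subst (conv (map pt (proj₁ result))) (trans sp.l l) (proj₂ (proj₂ result))
    where
    module sp = Split (split G gens)
    -- Needed by `cover-cone` in case `φ` vanishes at the first component. Total weight 1 excludes
    -- an empty combination, so some generator supplies the point.
    p₀ : ∃ (conv VP)
    p₀ = nonempty G gens w
      where
      nonempty : ∀ G → All (λ w → 0ℚ ≤ proj₁ w × Gen (proj₂ w)) G → wsum G ≡ 1ℚ → ∃ (conv VP)
      nonempty [] [] ()
      nonempty (_ ∷ _) ((_ , _ , p , _ , p∈ , _) ∷ _) _ = p , p∈
    a∈ : conv VQ (lin sp.α)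
    a∈ = cone⇒conv (subst (λ m → Cone (_∈ VQ) m (lin sp.α)) (trans sp.wα w) (flatten sp.nα sp.sα))
    q∈ : Cone (_∈ VP) (φ (lin sp.α)) (lin sp.β)
    q∈ = subst (λ m → Cone (_∈ VP) m (lin sp.β)) (trans sp.wβ (sym (affine-lin c c₀ sp.α (trans sp.wα w)))) (flatten sp.nβ sp.sβ)
    baseS = proj₁ (proj₂ (proj₂ triS)) (lin sp.α) a∈
    baseT = cover-cone triT id (proj₂ p₀) (φ-nonNeg _ a∈) q∈
    result = chain-cover (proj₁ (proj₂ baseS)) (proj₁ (proj₂ baseT)) (proj₂ (proj₁ (proj₂ (proj₂ baseT))))
      (conv⇒cone (proj₂ (proj₂ baseS))) (proj₂ (proj₂ (proj₂ baseT)))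

  -- The finite list of cells

  tokensOver : List (Point d) → List (Point e) → List Token
  -- Words shorter than the height are listed too; `chain?` rejects them later.
  tokensOver σ τ = concatMap (λ v → map (v ,_) (words (ht v) τ)) σ

  tokensOver⁺ : ∀ {σ τ t} → Good t → Over σ τ t → t ∈ tokensOver σ τ
  tokensOver⁺ {τ = τ} {v , s} (len , _) (v∈ , s∈) = ∈-concatMap⁺ (λ v → map (v ,_) (words (ht v) τ))
    (Any.map (λ { refl → ∈-map⁺ (v ,_) (words⁺ s∈ (ℕₚ.≤-reflexive len)) }) v∈)

  tokensOver⁻ : ∀ σ τ {t} → t ∈ tokensOver σ τ → Over σ τ t
  tokensOver⁻ σ τ {t} t∈ = unpack (find (∈-concatMap⁻ (λ v → map (v ,_) (words (ht v) τ)) {xs = σ} t∈))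
    where
    unpack : (∃ λ v → v ∈ σ × t ∈ map (v ,_) (words (ht v) τ)) → Over σ τ t
    unpack (v , v∈ , t∈) with ∈-map⁻ (v ,_) t∈
    ... | s , s∈ , refl = v∈ , words⁻ (ht v) s∈

  chain? : ∀ ts → Dec (Chain ts)
  chain? ts = All.all? good? ts ×-dec AllPairs.allPairs? (λ t t′ → nested? t t′ ×-dec ¬? (t ≟ᵗ t′)) ts
    where
    good? : ∀ t → Dec (Good t)
    good? (v , s) = (length s ℕ.≟ ht v) ×-dec ≼-dec s (drop 1 s)
    nested? : ∀ t t′ → Dec (t ⊴ t′)
    nested? (v , s) (v′ , s′) = OV._≤?_ v′ v ×-dec (≼-dec s s′ ×-dec ≼-dec s′ (drop 1 s))

  -- An empty `τ` gives nothing, since a cell must come with a vertex `w₀`. All chains are kept, not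
  -- only the maximal ones, so faces are listed along with the cells.
  chainsOver : List (Point d) → List (Point e) → List (List Token)
  chainsOver σ [] = []
  chainsOver σ τ@(_ ∷ _) = filter chain? (words (length (tokensOver σ τ)) (tokensOver σ τ))

  chains : List (List Token)
  chains = concatMap (λ σ → concatMap (chainsOver σ) T) S

  cells : List (List (Point (d ℕ.+ e)))
  cells = map (map pt) chains

  chains⁺ : ∀ {ts} → IsCell ts → ts ∈ chains
  chains⁺ {ts} cell = ∈-concatMap⁺ (λ σ → concatMap (chainsOver σ) T)
    (Any.map (λ { refl → ∈-concatMap⁺ (chainsOver σ) (Any.map (λ { refl → here-ts w₀∈τ over }) τ∈T) }) σ∈S)
    where
    open IsCell cell
    here-ts : ∀ {τ} → w₀ ∈ τ → All (Over σ τ) ts → ts ∈ chainsOver σ τ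
    here-ts {_ ∷ _} _ over = ∈-filter⁺ chain? (words⁺ among (unique-length (AllPairs.map proj₂ (proj₂ chain)) among)) chain
      where
      among = All.map (λ { (g , o) → tokensOver⁺ g o }) (All.zip (proj₁ chain , over))

  chains⁻ : ∀ {ts} → ts ∈ chains → IsCell ts
  chains⁻ {ts} ts∈ = overS (find (∈-concatMap⁻ (λ σ → concatMap (chainsOver σ) T) {xs = S} ts∈))
    where
    cell : ∀ {σ} τ → σ ∈ S → τ ∈ T → ts ∈ chainsOver σ τ → IsCell ts
    cell {σ} τ@(_ ∷ _) σ∈ τ∈ ts∈ = record
      { σ∈S = σ∈ ; τ∈T = τ∈ ; w₀∈τ = here refl
      ; over = All.map (tokensOver⁻ σ τ) (words⁻ (length (tokensOver σ τ)) (proj₁ found))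
      ; chain = proj₂ found
      }
      where
      found = ∈-filter⁻ chain? {xs = words (length (tokensOver σ τ)) (tokensOver σ τ)} ts∈
    overS : (∃ λ σ → σ ∈ S × ts ∈ concatMap (chainsOver σ) T) → IsCell ts
    overS (σ , σ∈ , ts∈) = overT (find (∈-concatMap⁻ (chainsOver σ) {xs = T} ts∈))
      where
      overT : (∃ λ τ → τ ∈ T × ts ∈ chainsOver σ τ) → IsCell ts
      overT (τ , τ∈ , ts∈) = cell τ σ∈ τ∈ ts∈

  every-cell : ∀ {P : List (Point (d ℕ.+ e)) → Set} → (∀ {ts} → IsCell ts → P (map pt ts)) → All P cells
  every-cell p = Allₚ.map⁺ (All.tabulate (λ ts∈ → p (chains⁻ ts∈)))

  cells-triangulate : IsUnimodularTriangulation (Semidirect (conv VQ) φ (conv VP)) cells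
  cells-triangulate =
    (every-cell cell-affIndep , every-cell cell-inside ,
      (λ x x∈ → let ts , cell , x∈cell = covered x x∈ in map pt ts , ∈-map⁺ (map pt) (chains⁺ cell) , x∈cell) ,
      λ σ τ σ∈ τ∈ → meets (∈-map⁻ (map pt) σ∈) (∈-map⁻ (map pt) τ∈)) ,
    every-cell cell-unimodular
    where
    meets : ∀ {σ τ} → (∃ λ ts → ts ∈ chains × σ ≡ map pt ts) → (∃ λ us → us ∈ chains × τ ≡ map pt us) →
      ∀ x → conv σ x → conv τ x → Conv (λ y → y ∈ σ × y ∈ τ) x
    meets (_ , ts∈ , refl) (_ , us∈ , refl) = cells-meet (chains⁻ ts∈) (chains⁻ us∈)

  cells-refine : RefinesPullback {d} {e} cells S
  cells-refine = every-cell λ cell → IsCell.σ cell , IsCell.σ∈S cell , cell-over cell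

theorem2p17 : (d e : ℕ) (VQ : List (Point d)) (VP : List (Point e)) →
    LatticePoints VQ → LatticePoints VP →
    (S : List (List (Point d))) → IsUnimodularTriangulation (conv VQ) S →
    (T : List (List (Point e))) → IsUnimodularTriangulation (conv VP) T →
    (c : Point d) (c₀ : ℚ) →
    (∀ a → IsLattice a → IsInt (affine c c₀ a)) →
    (∀ a → conv VQ a → 0ℚ ≤ affine c c₀ a) →
    ∃ λ (Σs : List (List (Point (d ℕ.+ e)))) →
    IsUnimodularTriangulation (Semidirect (conv VQ) (affine c c₀) (conv VP)) Σs
    × RefinesPullback {d} {e} Σs S
theorem2p17 d e VQ VP _ _ S uniS T uniT c c₀ φ-int φ-nonNeg = cells , cells-triangulate , cells-refine
  where open Construction d e VQ VP S uniS T uniT c c₀ φ-int φ-nonNeg
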